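{- Let the unit segment be fixed in the plane. A real number $r$ is RA-constructible if and only if $r$ can be obtained from $1$ by finitely many applications of the field operations $+,-,\times,\div$ (division by nonzero numbers), of $x\mapsto\sqrt{x}$ applied to previously obtained positive reals $x$, and of $x\mapsto\sin(\pi x)$ applied to previously obtained reals $x$. Likewise, a real number $r$ is RRA-constructible if and only if $r$ can be obtained from $1$ by finitely many applications of the field operations, of $x\mapsto\sqrt{x}$ applied to previously obtained positive reals $x$, and of $x\mapsto\frac{1}{\pi}\arcsin(x)$ applied to previously obtained reals $x$ with $|x|\le 1$.
   Context: Constructions take place in the Euclidean plane, starting from a segment declared to have length $1$ (it fixes Cartesian coordinates: the origin at one endpoint, the horizontal axis along the segment). The available tools are the straightedge (draw the line through two constructed points), the compass (draw the circle with a constructed center through a constructed point) and intersection of constructed lines/circles, together with one additional tool: - the right anglesector (RA): given two constructed segments of lengths $p,q$, it divides the right angle in the ratio $p:q$, i.e. produces the ray at angle $\frac{p}{q}\cdot\frac{\pi}{2}$ inside a given constructed right angle (for $p\le q$); - the reverse right anglesector (RRA): given a constructed acute angle $\theta$ inside a constructed right angle and a constructed segment, it divides that segment in the ratio $\theta:\frac{\pi}{2}$ (i.e. produces the point at fraction $\frac{2\theta}{\pi}$ of its length). A real number is RA-constructible (resp. RRA-constructible) if its absolute value is the length of a segment constructible from the unit segment with straightedge, compass and the RA (resp. RRA) tool. -}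

module Defs where

open import Algebra.Bundles using (CommutativeRing)
open import Algebra.Core using (Op₁)
open import Data.Product.Base using (∃; ∃-syntax; _×_; _,_)
open import Function.Bundles using (_⇔_)
open import Level using (0ℓ)
open import Relation.Binary.Core using (Rel)
open import Relation.Binary.Definitions using (tri<; tri≈; tri>)
open import Relation.Binary.Structures using (IsStrictTotalOrder)
open import Relation.Nullary.Negation.Core using (¬_)
import Relation.Binary.Construct.StrictToNonStrict as StrictToNonStrict

-- The real numbers are taken to be an arbitrary Dedekind-complete ordered
-- field, with a setoid equality; classically it is unique up to isomorphism.
record CompleteOrderedField : Set₁ where
  field
    commutativeRing : CommutativeRing 0ℓ 0ℓ

  open CommutativeRing commutativeRing public
    renaming (Carrier to ℝ)

  infix 4 _<_
  infix 9 _⁻¹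

  field
    _<_                : Rel ℝ 0ℓ
    isStrictTotalOrder : IsStrictTotalOrder _≈_ _<_
    0<1                : 0# < 1#
    +-monoʳ-<          : ∀ z {x y} → x < y → z + x < z + y
    *-pos              : ∀ {x y} → 0# < x → 0# < y → 0# < x * y
    _⁻¹                : Op₁ ℝ
    ⁻¹-cong            : ∀ {x y} → x ≈ y → x ⁻¹ ≈ y ⁻¹
    *-inverseʳ         : ∀ x → x ≉ 0# → x * x ⁻¹ ≈ 1#

  open IsStrictTotalOrder isStrictTotalOrder public
    using (compare; <-resp-≈)
    renaming (trans to <-trans; irrefl to <-irrefl)

  open StrictToNonStrict _≈_ _<_ public using (_≤_)

  IsUpperBound : (ℝ → Set) → ℝ → Set
  IsUpperBound P b = ∀ x → P x → x ≤ b

  IsSupremum : (ℝ → Set) → ℝ → Set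
  IsSupremum P s = IsUpperBound P s × (∀ b → IsUpperBound P b → s ≤ b)

  field
    complete : (P : ℝ → Set) → ∃ P → ∃ (IsUpperBound P) → ∃ (IsSupremum P)

  infixl 7 _/_
  _/_ : ℝ → ℝ → ℝ
  x / y = x * y ⁻¹

  2# : ℝ
  2# = 1# + 1#

  ∣_∣ : ℝ → ℝ
  ∣ x ∣ with compare x 0#
  ... | tri< _ _ _ = - x
  ... | tri≈ _ _ _ = x
  ... | tri> _ _ _ = x

  HasDerivative : (ℝ → ℝ) → (ℝ → ℝ) → Set
  HasDerivative f f′ =
    ∀ x ε → 0# < ε →
    ∃[ δ ] (0# < δ × (∀ h → ∣ h ∣ < δ → ∣ (f (x + h) - f x) - f′ x * h ∣ ≤ ε * ∣ h ∣))

-- sin and cos are the solutions of sin′ = cos, cos′ = - sin with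
-- sin 0 = 0, cos 0 = 1, and π is the least positive zero of sin.  These
-- conditions determine sin, cos and π uniquely.
record Trigonometry (R : CompleteOrderedField) : Set where
  open CompleteOrderedField R
  field
    sin cos  : ℝ → ℝ
    sin-cong : ∀ {x y} → x ≈ y → sin x ≈ sin y
    cos-cong : ∀ {x y} → x ≈ y → cos x ≈ cos y
    sin′     : HasDerivative sin cos
    cos′     : HasDerivative cos (λ x → - sin x)
    sin-0    : sin 0# ≈ 0#
    cos-0    : cos 0# ≈ 1#
    π        : ℝ
    0<π      : 0# < π
    sin-π    : sin π ≈ 0#
    π-least  : ∀ x → 0# < x → sin x ≈ 0# → π ≤ x

data Tool : Set where
  RA RRA : Tool

module Constructions (R : CompleteOrderedField) (T : Trigonometry R) where
  open CompleteOrderedField R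
  open Trigonometry T

  IsSqrt : ℝ → ℝ → Set
  IsSqrt x y = 0# ≤ y × y * y ≈ x

  IsArcsin : ℝ → ℝ → Set
  IsArcsin x θ = - (π / 2#) ≤ θ × θ ≤ π / 2# × sin θ ≈ x

  -- Numbers obtained from 1 by the field operations, square roots of positive
  -- numbers, and an extra (possibly partial) operation given by its graph _↦_.
  data Obtainable (_↦_ : ℝ → ℝ → Set) : ℝ → Set where
    one   : Obtainable _↦_ 1#
    add   : ∀ {x y} → Obtainable _↦_ x → Obtainable _↦_ y → Obtainable _↦_ (x + y)
    sub   : ∀ {x y} → Obtainable _↦_ x → Obtainable _↦_ y → Obtainable _↦_ (x - y)
    mul   : ∀ {x y} → Obtainable _↦_ x → Obtainable _↦_ y → Obtainable _↦_ (x * y)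
    div   : ∀ {x y} → Obtainable _↦_ x → Obtainable _↦_ y → y ≉ 0# → Obtainable _↦_ (x / y)
    sqrt  : ∀ {x y} → Obtainable _↦_ x → 0# < x → IsSqrt x y → Obtainable _↦_ y
    extra : ∀ {x y} → Obtainable _↦_ x → x ↦ y → Obtainable _↦_ y
    resp  : ∀ {x y} → x ≈ y → Obtainable _↦_ x → Obtainable _↦_ y

  SinπGraph : ℝ → ℝ → Set
  SinπGraph x y = y ≈ sin (π * x)

  Arcsin/πGraph : ℝ → ℝ → Set
  Arcsin/πGraph x y = ∣ x ∣ ≤ 1# × ∃[ θ ] (IsArcsin x θ × y ≈ (1# / π) * θ)

  Point : Set
  Point = ℝ × ℝ

  Vector : Set
  Vector = ℝ × ℝ

  infix 4 _≈ₚ_ _≉ₚ_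
  _≈ₚ_ _≉ₚ_ : Point → Point → Set
  (a , b) ≈ₚ (c , d) = a ≈ c × b ≈ d
  P ≉ₚ Q = ¬ (P ≈ₚ Q)

  infix 8 _⟶_
  _⟶_ : Point → Point → Vector
  (a , b) ⟶ (c , d) = (c - a , d - b)

  infixr 7 _·_
  _·_ : ℝ → Vector → Vector
  t · (a , b) = (t * a , t * b)

  infixl 6 _⊕_
  _⊕_ : Point → Vector → Point
  (a , b) ⊕ (c , d) = (a + c , b + d)

  ⟨_,_⟩ : Vector → Vector → ℝ
  ⟨ (a , b) , (c , d) ⟩ = a * c + b * d

  HasLength : Point → Point → ℝ → Set
  HasLength P Q ℓ = IsSqrt ⟨ P ⟶ Q , P ⟶ Q ⟩ ℓ

  -- The unoriented angle between the rays VA and VB has measure θ.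
  HasAngle : Point → Point → Point → ℝ → Set
  HasAngle A V B θ =
    A ≉ₚ V × B ≉ₚ V × 0# ≤ θ × θ ≤ π ×
    (∃[ a ] ∃[ b ] (HasLength V A a × HasLength V B b ×
      ⟨ V ⟶ A , V ⟶ B ⟩ ≈ a * b * cos θ))

  IsRightAngle : Point → Point → Point → Set
  IsRightAngle A V B = HasAngle A V B (π / 2#)

  -- W lies in the closed convex sector spanned by the rays VA and VB.
  InsideAngle : Point → Point → Point → Point → Set
  InsideAngle A V B W =
    ∃[ s ] ∃[ t ] (0# ≤ s × 0# ≤ t × W ≈ₚ V ⊕ s · (V ⟶ A) ⊕ t · (V ⟶ B))

  data Figure : Set where
    line   : Point → Point → Figure   -- through both points
    circle : Point → Point → Figure   -- centre, point on the circle
    ray    : Point → Point → Figure   -- endpoint, another point of the ray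

  infix 4 _on_
  _on_ : Point → Figure → Set
  X on line A B   = ∃[ t ] X ≈ₚ A ⊕ t · (A ⟶ B)
  X on circle O A = ⟨ O ⟶ X , O ⟶ X ⟩ ≈ ⟨ O ⟶ A , O ⟶ A ⟩
  X on ray V W    = ∃[ t ] (0# ≤ t × X ≈ₚ V ⊕ t · (V ⟶ W))

  support : Figure → Figure
  support (ray V W) = line V W
  support f         = f

  -- Figures on a common line overlap in a segment or ray whose points are not
  -- all constructed, so only figures with different supports are intersected.
  Distinct : Figure → Figure → Set
  Distinct f g = ¬ (∀ X → (X on support f) ⇔ (X on support g))

  data Constructed : Tool → Point → Set
  data Drawn       : Tool → Figure → Set

  data Constructed where
    origin    : ∀ {τ} → Constructed τ (0# , 0#)
    unit      : ∀ {τ} → Constructed τ (1# , 0#)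
    intersect : ∀ {τ f g X} → Drawn τ f → Drawn τ g → Distinct f g →
                X on f → X on g → Constructed τ X
    divide    : ∀ {A V B W P Q θ} →
                Constructed RRA A → Constructed RRA V → Constructed RRA B →
                IsRightAngle A V B →
                Constructed RRA W → InsideAngle A V B W →
                HasAngle A V W θ → 0# < θ → θ < π / 2# →
                Constructed RRA P → Constructed RRA Q →
                Constructed RRA (P ⊕ (2# * θ / π) · (P ⟶ Q))
    resp      : ∀ {τ X Y} → X ≈ₚ Y → Constructed τ X → Constructed τ Y

  data Drawn where
    straightedge : ∀ {τ A B} → Constructed τ A → Constructed τ B → A ≉ₚ B →
                   Drawn τ (line A B)
    compass      : ∀ {τ O A} → Constructed τ O → Constructed τ A → O ≉ₚ A →
                   Drawn τ (circle O A)
    -- W is any point of the ray produced; it is not itself constructed.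
    anglesect    : ∀ {A V B W P Q P′ Q′ p q} →
                   Constructed RA A → Constructed RA V → Constructed RA B →
                   IsRightAngle A V B →
                   Constructed RA P → Constructed RA Q → HasLength P Q p →
                   Constructed RA P′ → Constructed RA Q′ → HasLength P′ Q′ q →
                   0# < q → p ≤ q →
                   InsideAngle A V B W → HasAngle A V W (p / q * (π / 2#)) →
                   Drawn RA (ray V W)

  -- Degenerate segments count, so that 0 is constructible.
  Constructible : Tool → ℝ → Set
  Constructible τ r =
    ∃[ P ] ∃[ Q ] (Constructed τ P × Constructed τ Q × HasLength P Q ∣ r ∣)

{-# OPTIONS --safe #-}

-- From right to left, the points (x, 0) with x obtainable are constructed.
-- A 3-4-5 triangle gives perpendiculars, these give midpoints, and midpoints
-- give the fourth vertex of a parallelogram, hence parallels and the classical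
-- constructions of x + y, x / y and √x.  The RA ray at angle πx meets the unit
-- circle at (cos πx, sin πx) for 0 ≤ x ≤ ½; other x reduce to this case by
-- quarter turns and parity.  The RRA tool applied to the direction
-- (√(1 − x²), x) divides the unit segment in the ratio 2 arcsin(x) : π.
--
-- From left to right, every drawn line or circle has an equation with
-- obtainable coefficients.  An intersection point solves a linear system or a
-- quadratic equation whose discriminant is an obtainable square.  The ray drawn
-- by the RA tool has direction built from sin and cos of an obtainable multiple
-- of π, and the ratio used by the RRA tool is 2/π times the arcsine of an
-- obtainable sine.
--
-- The facts about sin, cos and π follow from their differential equations:
-- f u + g v is constant whenever f′ = g, g′ = −f, u′ = v and v′ = −u.
module Submission where

open import Defs
open import Algebra.Bundles using (CommutativeRing)
open import Axiom.ExcludedMiddle using (ExcludedMiddle)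
open import Data.Empty using (⊥-elim)
open import Data.Integer.Base as ℤ using (ℤ; +_; -[1+_]; _⊖_)
open import Data.Maybe.Base using (Maybe; map)
open import Data.Nat.Base as ℕ using (ℕ; zero; suc)
open import Data.Product.Base using (∃-syntax; _×_; _,_; proj₁; proj₂)
open import Data.Sum.Base using (_⊎_; inj₁; inj₂)
open import Function.Bundles using (_⇔_; mk⇔; Equivalence)
open import Level using (0ℓ)
open import Relation.Binary.Definitions using (tri<; tri≈; tri>)
open import Relation.Nullary.Decidable using (yes; no; dec⇒maybe)
open import Relation.Nullary.Negation.Core using (¬_)
open import Algebra.Solver.Ring.AlmostCommutativeRing using (fromCommutativeRing; _-Raw-AlmostCommutative⟶_)
import Algebra.Properties.Ring
import Algebra.Properties.Semiring.Mult.TCOptimised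
import Algebra.Solver.Ring
import Data.Integer.Properties as ℤ
import Data.Nat.Properties as ℕ
import Data.Sign.Base as Sign
import Relation.Binary.Construct.StrictToNonStrict as StrictToNonStrict
import Relation.Binary.PropositionalEquality.Core as ≡
import Relation.Binary.Reasoning.Setoid

-- `intersect` accepts a point only with proofs that it lies on both figures, so every construction
-- must know the coordinates of its point in advance. This is why perpendiculars come from a 3-4-5
-- triangle: its apex is rational in the given coordinates, whereas an equilateral triangle would
-- first require that √3 exists. The compass is collapsing, as it draws only circles through
-- constructed points; translations therefore come from reflections, not from transported lengths.
--
-- In the other direction the obstacle is `Distinct`, which compares figures as sets of points. A
-- degenerate system of equations has to be turned into equality of loci, so each locus is described
-- by an equation equivalent to membership. Moreover the point naming a drawn ray is not constructed
-- and its coordinates may fail to be obtainable; only its direction, up to an unknown factor, can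
-- be used.
--
-- Completeness enters through a single local-to-global principle for intervals, which stands in for
-- the intermediate and mean value theorems.

-- Polynomial identities with integer coefficients

module IntegerSolver (CR : CommutativeRing 0ℓ 0ℓ) where
  open CommutativeRing CR
  open Algebra.Properties.Ring ring
  open Algebra.Properties.Semiring.Mult.TCOptimised semiring
    using (1+×; ×-homo-+; ×1-homo-*) renaming (_×_ to _ℕ×_)
  open Relation.Binary.Reasoning.Setoid setoid

  fromℕ : ℕ → Carrier
  fromℕ n = n ℕ× 1#

  fromℤ : ℤ → Carrier
  fromℤ (+ n)    = fromℕ n
  fromℤ -[1+ n ] = - fromℕ (suc n)

  fromℤ-⊖ : ∀ m n → fromℤ (m ⊖ n) ≈ fromℕ m - fromℕ n
  fromℤ-⊖ m zero = begin
    fromℕ m         ≈⟨ +-identityʳ _ ⟨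
    fromℕ m + 0#    ≈⟨ +-congˡ -0#≈0# ⟨
    fromℕ m - 0#    ∎
  fromℤ-⊖ zero (suc n) = sym (+-identityˡ _)
  fromℤ-⊖ (suc m) (suc n) = begin
    fromℤ (suc m ⊖ suc n)                   ≡⟨ ≡.cong fromℤ (ℤ.[1+m]⊖[1+n]≡m⊖n m n) ⟩
    fromℤ (m ⊖ n)                           ≈⟨ fromℤ-⊖ m n ⟩
    fromℕ m - fromℕ n                       ≈⟨ +-congʳ (+-identityʳ _) ⟨
    (fromℕ m + 0#) - fromℕ n                ≈⟨ +-congʳ (+-congˡ (-‿inverseʳ 1#)) ⟨
    (fromℕ m + (1# - 1#)) - fromℕ n         ≈⟨ +-congʳ (+-assoc _ _ _) ⟨
    ((fromℕ m + 1#) - 1#) - fromℕ n         ≈⟨ +-assoc _ _ _ ⟩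
    (fromℕ m + 1#) + (- 1# - fromℕ n)       ≈⟨ +-cong (+-comm _ _) (-‿+-comm 1# _) ⟩
    (1# + fromℕ m) - (1# + fromℕ n)         ≈⟨ +-cong (1+× m 1#) (-‿cong (1+× n 1#)) ⟨
    fromℕ (suc m) - fromℕ (suc n)           ∎

  fromℤ-+ : ∀ i j → fromℤ (i ℤ.+ j) ≈ fromℤ i + fromℤ j
  fromℤ-+ (+ m)    (+ n)    = ×-homo-+ 1# m n
  fromℤ-+ (+ m)    -[1+ n ] = fromℤ-⊖ m (suc n)
  fromℤ-+ -[1+ m ] (+ n)    = trans (fromℤ-⊖ n (suc m)) (+-comm _ _)
  fromℤ-+ -[1+ m ] -[1+ n ] = begin
    - fromℕ (suc (suc (m ℕ.+ n)))        ≡⟨ ≡.cong (λ k → - fromℕ (suc k)) (ℕ.+-suc m n) ⟨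
    - fromℕ (suc m ℕ.+ suc n)            ≈⟨ -‿cong (×-homo-+ 1# (suc m) (suc n)) ⟩
    - (fromℕ (suc m) + fromℕ (suc n))    ≈⟨ -‿+-comm _ _ ⟨
    - fromℕ (suc m) - fromℕ (suc n)      ∎

  fromℤ-neg : ∀ i → fromℤ (ℤ.- i) ≈ - fromℤ i
  fromℤ-neg (+ zero)  = sym -0#≈0#
  fromℤ-neg (+ suc n) = refl
  fromℤ-neg -[1+ n ]  = sym (-‿involutive _)

  fromℤ-◃- : ∀ n → fromℤ (Sign.- ℤ.◃ n) ≈ - fromℕ n
  fromℤ-◃- zero    = sym -0#≈0#
  fromℤ-◃- (suc n) = refl

  fromℤ-◃+ : ∀ n → fromℤ (Sign.+ ℤ.◃ n) ≈ fromℕ n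
  fromℤ-◃+ zero    = refl
  fromℤ-◃+ (suc n) = refl

  fromℤ-* : ∀ i j → fromℤ (i ℤ.* j) ≈ fromℤ i * fromℤ j
  fromℤ-* (+ m)    (+ n)    = trans (fromℤ-◃+ (m ℕ.* n)) (×1-homo-* m n)
  fromℤ-* (+ m)    -[1+ n ] = begin
    fromℤ (Sign.- ℤ.◃ (m ℕ.* suc n))     ≈⟨ fromℤ-◃- (m ℕ.* suc n) ⟩
    - fromℕ (m ℕ.* suc n)                ≈⟨ -‿cong (×1-homo-* m (suc n)) ⟩
    - (fromℕ m * fromℕ (suc n))          ≈⟨ -‿distribʳ-* _ _ ⟩
    fromℕ m * - fromℕ (suc n)            ∎
  fromℤ-* -[1+ m ] (+ n)    = begin
    fromℤ (Sign.- ℤ.◃ (suc m ℕ.* n))     ≈⟨ fromℤ-◃- (suc m ℕ.* n) ⟩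
    - fromℕ (suc m ℕ.* n)                ≈⟨ -‿cong (×1-homo-* (suc m) n) ⟩
    - (fromℕ (suc m) * fromℕ n)          ≈⟨ -‿distribˡ-* _ _ ⟩
    - fromℕ (suc m) * fromℕ n            ∎
  fromℤ-* -[1+ m ] -[1+ n ] = begin
    fromℕ (suc m ℕ.* suc n)              ≈⟨ ×1-homo-* (suc m) (suc n) ⟩
    fromℕ (suc m) * fromℕ (suc n)        ≈⟨ -‿involutive _ ⟨
    - (- (fromℕ (suc m) * fromℕ (suc n)))  ≈⟨ -‿cong (-‿distribˡ-* _ _) ⟩
    - (- fromℕ (suc m) * fromℕ (suc n))  ≈⟨ -‿distribʳ-* _ _ ⟩
    - fromℕ (suc m) * - fromℕ (suc n)    ∎

  ℤ⟶R : ℤ.+-*-rawRing -Raw-AlmostCommutative⟶ fromCommutativeRing CR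
  ℤ⟶R = record
    { ⟦_⟧    = fromℤ
    ; +-homo = fromℤ-+
    ; *-homo = fromℤ-*
    ; -‿homo = fromℤ-neg
    ; 0-homo = refl
    ; 1-homo = refl
    }

  -- Comparing integers instead of ring elements lets numerals cancel by computation. Unequal
  -- integers yield no verdict, so the ring may have any characteristic.
  fromℤ-≟ : ∀ i j → Maybe (fromℤ i ≈ fromℤ j)
  fromℤ-≟ i j = map (λ i≡j → reflexive (≡.cong fromℤ i≡j)) (dec⇒maybe (i ℤ.≟ j))

  open Algebra.Solver.Ring ℤ.+-*-rawRing (fromCommutativeRing CR) ℤ⟶R fromℤ-≟ public
    using (solve; _:=_; _:+_; _:*_; _:-_; :-_; con; Polynomial)

  :0 :1 :2 : ∀ {n} → Polynomial n
  :0 = con (+ 0)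
  :1 = con (+ 1)
  :2 = :1 :+ :1

-- Inequalities, halves and absolute values in an ordered field

module OrderedField (R : CompleteOrderedField) where
  open CompleteOrderedField R
  open IntegerSolver commutativeRing
  private module S = StrictToNonStrict _≈_ _<_

  ≈-from-difference : ∀ {x y} → x - y ≈ 0# → x ≈ y
  ≈-from-difference {x} {y} x-y≈0 = trans
    (solve 2 (λ x y → x := (x :- y) :+ y) refl x y)
    (trans (+-congʳ x-y≈0) (+-identityˡ y))

  difference≈0 : ∀ {x y} → x ≈ y → x - y ≈ 0#
  difference≈0 {x} {y} x≈y = trans (+-congʳ x≈y) (-‿inverseʳ y)

  *-difference≈0 : ∀ c {x y} → x ≈ y → c * (x - y) ≈ 0#
  *-difference≈0 c x≈y = trans (*-congˡ (difference≈0 x≈y)) (zeroʳ c)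

  -- An equation is derived from hypotheses by exhibiting the difference of
  -- its sides as a linear combination of the differences of theirs.
  combine₁ : ∀ {x y} c {l r} → l ≈ r → x - y ≈ c * (l - r) → x ≈ y
  combine₁ c l≈r e = ≈-from-difference (trans e (*-difference≈0 c l≈r))

  combine₂ : ∀ {x y} c {l r} → l ≈ r → ∀ c′ {l′ r′} → l′ ≈ r′ →
             x - y ≈ c * (l - r) + c′ * (l′ - r′) → x ≈ y
  combine₂ c l≈r c′ l′≈r′ e = ≈-from-difference (trans e
    (trans (+-cong (*-difference≈0 c l≈r) (*-difference≈0 c′ l′≈r′)) (+-identityˡ 0#)))

  combine₃ : ∀ {x y} c {l r} → l ≈ r → ∀ c′ {l′ r′} → l′ ≈ r′ →
             ∀ c″ {l″ r″} → l″ ≈ r″ →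
             x - y ≈ c * (l - r) + c′ * (l′ - r′) + c″ * (l″ - r″) → x ≈ y
  combine₃ c l≈r c′ l′≈r′ c″ l″≈r″ e = ≈-from-difference (trans e (trans
    (+-cong (trans (+-cong (*-difference≈0 c l≈r) (*-difference≈0 c′ l′≈r′)) (+-identityˡ 0#))
            (*-difference≈0 c″ l″≈r″))
    (+-identityˡ 0#)))

  <-respʳ : ∀ {x y z} → y ≈ z → x < y → x < z
  <-respʳ = proj₁ <-resp-≈

  <-respˡ : ∀ {x y z} → y ≈ z → y < x → z < x
  <-respˡ = proj₂ <-resp-≈

  ≤-refl : ∀ {x} → x ≤ x
  ≤-refl = inj₂ refl

  <⇒≤ : ∀ {x y} → x < y → x ≤ y
  <⇒≤ = inj₁

  ≤-trans : ∀ {x y z} → x ≤ y → y ≤ z → x ≤ z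
  ≤-trans = S.trans isEquivalence <-resp-≈ <-trans

  ≤-antisym : ∀ {x y} → x ≤ y → y ≤ x → x ≈ y
  ≤-antisym = S.antisym isEquivalence <-trans <-irrefl

  <-≤-trans : ∀ {x y z} → x < y → y ≤ z → x < z
  <-≤-trans = S.<-≤-trans <-trans <-respʳ

  ≤-<-trans : ∀ {x y z} → x ≤ y → y < z → x < z
  ≤-<-trans = S.≤-<-trans sym <-trans <-respˡ

  ≤-respʳ : ∀ {x y z} → y ≈ z → x ≤ y → x ≤ z
  ≤-respʳ y≈z x≤y = ≤-trans x≤y (inj₂ y≈z)

  ≤-respˡ : ∀ {x y z} → y ≈ z → y ≤ x → z ≤ x
  ≤-respˡ y≈z y≤x = ≤-trans (inj₂ (sym y≈z)) y≤x

  <⇒≱ : ∀ {x y} → x < y → ¬ (y ≤ x)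
  <⇒≱ x<y y≤x = <-irrefl refl (<-≤-trans x<y y≤x)

  >⇒≉ : ∀ {x y} → y < x → x ≉ y
  >⇒≉ y<x x≈y = <-irrefl (sym x≈y) y<x

  <-or-≥ : ∀ x y → x < y ⊎ y ≤ x
  <-or-≥ x y with compare x y
  ... | tri< x<y _ _ = inj₁ x<y
  ... | tri≈ _ x≈y _ = inj₂ (inj₂ (sym x≈y))
  ... | tri> _ _ y<x = inj₂ (inj₁ y<x)

  ≈0-or-≉0 : ∀ x → x ≈ 0# ⊎ x ≉ 0#
  ≈0-or-≉0 x with compare x 0#
  ... | tri< _ x≉0 _ = inj₂ x≉0
  ... | tri≈ _ x≈0 _ = inj₁ x≈0
  ... | tri> _ x≉0 _ = inj₂ x≉0

  <-from-difference : ∀ {x y d} → 0# < d → y - x ≈ d → x < y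
  <-from-difference {x} {y} 0<d y-x≈d =
    <-respˡ (+-identityʳ x)
      (<-respʳ (solve 2 (λ x y → x :+ (y :- x) := y) refl x y)
        (+-monoʳ-< x (<-respʳ (sym y-x≈d) 0<d)))

  ≤-from-difference : ∀ {x y d} → 0# ≤ d → y - x ≈ d → x ≤ y
  ≤-from-difference (inj₁ 0<d) y-x≈d = inj₁ (<-from-difference 0<d y-x≈d)
  ≤-from-difference (inj₂ 0≈d) y-x≈d = inj₂ (sym (≈-from-difference (trans y-x≈d (sym 0≈d))))

  0<difference : ∀ {x y} → x < y → 0# < y - x
  0<difference {x} {y} x<y =
    <-respˡ (-‿inverseˡ x) (<-respʳ (+-comm (- x) y) (+-monoʳ-< (- x) x<y))

  0≤difference : ∀ {x y} → x ≤ y → 0# ≤ y - x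
  0≤difference (inj₁ x<y) = inj₁ (0<difference x<y)
  0≤difference (inj₂ x≈y) = inj₂ (sym (difference≈0 (sym x≈y)))

  +-nonneg-pos : ∀ {x y} → 0# ≤ x → 0# < y → 0# < x + y
  +-nonneg-pos {x} {y} 0≤x 0<y =
    ≤-<-trans 0≤x (<-respˡ (+-identityʳ x) (+-monoʳ-< x 0<y))

  +-pos-nonneg : ∀ {x y} → 0# < x → 0# ≤ y → 0# < x + y
  +-pos-nonneg {x} {y} 0<x 0≤y = <-respʳ (+-comm y x) (+-nonneg-pos 0≤y 0<x)

  +-pos : ∀ {x y} → 0# < x → 0# < y → 0# < x + y
  +-pos 0<x 0<y = +-nonneg-pos (<⇒≤ 0<x) 0<y

  +-nonneg : ∀ {x y} → 0# ≤ x → 0# ≤ y → 0# ≤ x + y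
  +-nonneg 0≤x (inj₁ 0<y) = inj₁ (+-nonneg-pos 0≤x 0<y)
  +-nonneg {x} 0≤x (inj₂ 0≈y) = ≤-respʳ (trans (sym (+-identityʳ x)) (+-congˡ 0≈y)) 0≤x

  *-nonneg : ∀ {x y} → 0# ≤ x → 0# ≤ y → 0# ≤ x * y
  *-nonneg (inj₁ 0<x) (inj₁ 0<y) = inj₁ (*-pos 0<x 0<y)
  *-nonneg {x} (inj₁ _) (inj₂ 0≈y) = inj₂ (trans (sym (zeroʳ x)) (*-congˡ 0≈y))
  *-nonneg {x} {y} (inj₂ 0≈x) _ = inj₂ (trans (sym (zeroˡ y)) (*-congʳ 0≈x))

  +-mono-≤ : ∀ {w x y z} → w ≤ x → y ≤ z → w + y ≤ x + z
  +-mono-≤ {w} {x} {y} {z} w≤x y≤z =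
    ≤-from-difference (+-nonneg (0≤difference w≤x) (0≤difference y≤z))
      (solve 4 (λ w x y z → (x :+ z) :- (w :+ y) := (x :- w) :+ (z :- y)) refl w x y z)

  *-monoˡ-≤ : ∀ {c x y} → 0# ≤ c → x ≤ y → c * x ≤ c * y
  *-monoˡ-≤ {c} {x} {y} 0≤c x≤y =
    ≤-from-difference (*-nonneg 0≤c (0≤difference x≤y))
      (solve 3 (λ c x y → c :* y :- c :* x := c :* (y :- x)) refl c x y)

  *-mono-≤ : ∀ {w x y z} → 0# ≤ w → 0# ≤ y → w ≤ x → y ≤ z → w * y ≤ x * z
  *-mono-≤ {w} {x} {y} {z} 0≤w 0≤y w≤x y≤z = ≤-trans
    (*-monoˡ-≤ 0≤w y≤z)
    (≤-respˡ (*-comm z w) (≤-respʳ (*-comm z x) (*-monoˡ-≤ (≤-trans 0≤y y≤z) w≤x)))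

  neg-nonneg : ∀ {x} → x ≤ 0# → 0# ≤ - x
  neg-nonneg {x} x≤0 = ≤-respʳ (+-identityˡ (- x)) (0≤difference x≤0)

  neg-pos : ∀ {x} → x < 0# → 0# < - x
  neg-pos {x} x<0 = <-respʳ (+-identityˡ (- x)) (0<difference x<0)

  square-nonneg : ∀ x → 0# ≤ x * x
  square-nonneg x with <-or-≥ x 0#
  ... | inj₁ x<0 = ≤-respʳ (solve 1 (λ x → :- x :* :- x := x :* x) refl x)
                           (<⇒≤ (*-pos (neg-pos x<0) (neg-pos x<0)))
  ... | inj₂ 0≤x = *-nonneg 0≤x 0≤x

  square-pos : ∀ {x} → x ≉ 0# → 0# < x * x
  square-pos {x} x≉0 with compare x 0#
  ... | tri< x<0 _ _ = <-respʳ (solve 1 (λ x → :- x :* :- x := x :* x) refl x)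
                               (*-pos (neg-pos x<0) (neg-pos x<0))
  ... | tri≈ _ x≈0 _ = ⊥-elim (x≉0 x≈0)
  ... | tri> _ _ 0<x = *-pos 0<x 0<x

  x*y≈0⇒y≈0 : ∀ {x y} → x ≉ 0# → x * y ≈ 0# → y ≈ 0#
  x*y≈0⇒y≈0 {x} {y} x≉0 xy≈0 =
    combine₂ (x ⁻¹) xy≈0 (- y) (*-inverseʳ x x≉0)
      (solve 3 (λ x y i → y :- :0 := i :* (x :* y :- :0) :+ :- y :* (x :* i :- :1)) refl x y (x ⁻¹))

  *-cancelˡ : ∀ {x y z} → x ≉ 0# → x * y ≈ x * z → y ≈ z
  *-cancelˡ {x} {y} {z} x≉0 xy≈xz = ≈-from-difference (x*y≈0⇒y≈0 x≉0
    (combine₁ 1# xy≈xz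
      (solve 3 (λ x y z → x :* (y :- z) :- :0 := :1 :* (x :* y :- x :* z)) refl x y z)))

  *-≉0 : ∀ {x y} → x ≉ 0# → y ≉ 0# → x * y ≉ 0#
  *-≉0 x≉0 y≉0 xy≈0 = y≉0 (x*y≈0⇒y≈0 x≉0 xy≈0)

  /-cancel : ∀ {x y} → y ≉ 0# → y * (x / y) ≈ x
  /-cancel {x} {y} y≉0 = combine₁ x (*-inverseʳ y y≉0)
    (solve 3 (λ x y i → y :* (x :* i) :- x := x :* (y :* i :- :1)) refl x y (y ⁻¹))

  ⁻¹-pos : ∀ {x} → 0# < x → 0# < x ⁻¹
  ⁻¹-pos {x} 0<x with compare (x ⁻¹) 0#
  ... | tri> _ _ 0<i = 0<i
  ... | tri≈ _ i≈0 _ = ⊥-elim (<-irrefl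
          (trans (sym (zeroʳ x)) (trans (*-congˡ (sym i≈0)) (*-inverseʳ x (>⇒≉ 0<x)))) 0<1)
  ... | tri< i<0 _ _ = ⊥-elim (<-irrefl refl (<-trans 0<1 (<-from-difference
          (*-pos 0<x (neg-pos i<0))
          (combine₁ 1# (*-inverseʳ x (>⇒≉ 0<x))
            (solve 2 (λ x i → ((:0 :- :1) :- x :* :- i) := :1 :* (x :* i :- :1)) refl x (x ⁻¹))))))

  /-pos : ∀ {x y} → 0# < x → 0# < y → 0# < x / y
  /-pos 0<x 0<y = *-pos 0<x (⁻¹-pos 0<y)

  0<2 : 0# < 2#
  0<2 = +-pos 0<1 0<1

  2≉0 : 2# ≉ 0#
  2≉0 = >⇒≉ 0<2

  ½ : ℝ
  ½ = 2# ⁻¹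

  2*½ : 2# * ½ ≈ 1#
  2*½ = *-inverseʳ 2# 2≉0

  0<½ : 0# < ½
  0<½ = ⁻¹-pos 0<2

  ½-halves : ∀ x → ½ * x + ½ * x ≈ x
  ½-halves x = combine₁ x 2*½
    (solve 2 (λ x i → (i :* x :+ i :* x) :- x := x :* (:2 :* i :- :1)) refl x ½)

  half-pos : ∀ {x} → 0# < x → 0# < ½ * x
  half-pos = *-pos 0<½

  half-< : ∀ {x} → 0# < x → ½ * x < x
  half-< {x} 0<x = <-from-difference (half-pos 0<x)
    (combine₁ (- x) 2*½
      (solve 2 (λ x i → (x :- i :* x) :- i :* x := :- x :* (:2 :* i :- :1)) refl x ½))

  -- Factor x² - y² as (x + y)(x - y). If x + y = 0, then y - x = 2y and x - y = 2x are both
  -- nonnegative.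
  square-injective : ∀ {x y} → 0# ≤ x → 0# ≤ y → x * x ≈ y * y → x ≈ y
  square-injective {x} {y} 0≤x 0≤y xx≈yy with ≈0-or-≉0 (x + y)
  ... | inj₁ x+y≈0 = ≤-antisym
          (≤-from-difference (+-nonneg 0≤y 0≤y)
            (combine₁ (- 1#) x+y≈0
              (solve 2 (λ x y → (y :- x) :- (y :+ y) := :- :1 :* (x :+ y :- :0)) refl x y)))
          (≤-from-difference (+-nonneg 0≤x 0≤x)
            (combine₁ (- 1#) x+y≈0
              (solve 2 (λ x y → (x :- y) :- (x :+ x) := :- :1 :* (x :+ y :- :0)) refl x y)))
  ... | inj₂ x+y≉0 = ≈-from-difference (x*y≈0⇒y≈0 x+y≉0
          (combine₁ 1# xx≈yy
            (solve 2 (λ x y → (x :+ y) :* (x :- y) :- :0 := :1 :* (x :* x :- y :* y)) refl x y)))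

  squares-pos : ∀ {x y} → ¬ (x ≈ 0# × y ≈ 0#) → 0# < x * x + y * y
  squares-pos {x} {y} ¬0 with ≈0-or-≉0 x | ≈0-or-≉0 y
  ... | inj₂ x≉0 | _        = +-pos-nonneg (square-pos x≉0) (square-nonneg y)
  ... | inj₁ _   | inj₂ y≉0 = +-nonneg-pos (square-nonneg x) (square-pos y≉0)
  ... | inj₁ x≈0 | inj₁ y≈0 = ⊥-elim (¬0 (x≈0 , y≈0))

  ∣∣-cases : ∀ x → (0# ≤ x × ∣ x ∣ ≈ x) ⊎ (x < 0# × ∣ x ∣ ≈ - x)
  ∣∣-cases x with compare x 0#
  ... | tri< x<0 _ _ = inj₂ (x<0 , refl)
  ... | tri≈ _ x≈0 _ = inj₁ (inj₂ (sym x≈0) , refl)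
  ... | tri> _ _ 0<x = inj₁ (inj₁ 0<x , refl)

  ∣∣-nonneg : ∀ x → 0# ≤ ∣ x ∣
  ∣∣-nonneg x with ∣∣-cases x
  ... | inj₁ (0≤x , e) = ≤-respʳ (sym e) 0≤x
  ... | inj₂ (x<0 , e) = ≤-respʳ (sym e) (<⇒≤ (neg-pos x<0))

  neg-≤ : ∀ {x y} → x ≤ y → - y ≤ - x
  neg-≤ {x} {y} x≤y = ≤-from-difference (0≤difference x≤y)
    (solve 2 (λ x y → :- x :- :- y := y :- x) refl x y)

  x≤∣x∣ : ∀ x → x ≤ ∣ x ∣
  x≤∣x∣ x with ∣∣-cases x
  ... | inj₁ (_ , e)   = inj₂ (sym e)
  ... | inj₂ (x<0 , _) = ≤-trans (<⇒≤ x<0) (∣∣-nonneg x)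

  -x≤∣x∣ : ∀ x → - x ≤ ∣ x ∣
  -x≤∣x∣ x with ∣∣-cases x
  ... | inj₁ (0≤x , _) = ≤-trans (≤-respʳ (solve 0 (:- :0 := :0) refl) (neg-≤ 0≤x)) (∣∣-nonneg x)
  ... | inj₂ (_ , e)   = inj₂ (sym e)

  ∣∣-≤ : ∀ {x y} → x ≤ y → - x ≤ y → ∣ x ∣ ≤ y
  ∣∣-≤ {x} x≤y -x≤y with ∣∣-cases x
  ... | inj₁ (_ , e) = ≤-respˡ (sym e) x≤y
  ... | inj₂ (_ , e) = ≤-respˡ (sym e) -x≤y

  ∣∣-< : ∀ {x y} → x < y → - x < y → ∣ x ∣ < y
  ∣∣-< {x} x<y -x<y with ∣∣-cases x
  ... | inj₁ (_ , e) = <-respˡ (sym e) x<y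
  ... | inj₂ (_ , e) = <-respˡ (sym e) -x<y

  ∣∣-cong : ∀ {x y} → x ≈ y → ∣ x ∣ ≈ ∣ y ∣
  ∣∣-cong {x} {y} x≈y = ≤-antisym
    (∣∣-≤ (≤-respˡ (sym x≈y) (x≤∣x∣ y)) (≤-respˡ (-‿cong (sym x≈y)) (-x≤∣x∣ y)))
    (∣∣-≤ (≤-respˡ x≈y (x≤∣x∣ x)) (≤-respˡ (-‿cong x≈y) (-x≤∣x∣ x)))

  0≤x⇒∣x∣≈x : ∀ {x} → 0# ≤ x → ∣ x ∣ ≈ x
  0≤x⇒∣x∣≈x {x} 0≤x with ∣∣-cases x
  ... | inj₁ (_ , e)   = e
  ... | inj₂ (x<0 , _) = ⊥-elim (<⇒≱ x<0 0≤x)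

  ∣-x∣≈∣x∣ : ∀ x → ∣ - x ∣ ≈ ∣ x ∣
  ∣-x∣≈∣x∣ x = ≤-antisym
    (∣∣-≤ (-x≤∣x∣ x) (≤-respˡ (sym -‿involutive) (x≤∣x∣ x)))
    (∣∣-≤ (≤-respˡ -‿involutive (-x≤∣x∣ (- x))) (x≤∣x∣ (- x)))
    where
    -‿involutive : - - x ≈ x
    -‿involutive = solve 1 (λ x → :- :- x := x) refl x

  ∣∣-+ : ∀ x y → ∣ x + y ∣ ≤ ∣ x ∣ + ∣ y ∣
  ∣∣-+ x y = ∣∣-≤ (+-mono-≤ (x≤∣x∣ x) (x≤∣x∣ y))
    (≤-respˡ (solve 2 (λ x y → :- x :+ :- y := :- (x :+ y)) refl x y)
      (+-mono-≤ (-x≤∣x∣ x) (-x≤∣x∣ y)))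

  ∣∣-square : ∀ x → ∣ x ∣ * ∣ x ∣ ≈ x * x
  ∣∣-square x with ∣∣-cases x
  ... | inj₁ (_ , e) = *-cong e e
  ... | inj₂ (_ , e) = trans (*-cong e e) (solve 1 (λ x → :- x :* :- x := x :* x) refl x)

  -- Both sides are nonnegative with the same square, which avoids the four combinations of signs.
  ∣∣-* : ∀ x y → ∣ x * y ∣ ≈ ∣ x ∣ * ∣ y ∣
  ∣∣-* x y = square-injective (∣∣-nonneg (x * y)) (*-nonneg (∣∣-nonneg x) (∣∣-nonneg y))
    (trans (∣∣-square (x * y))
      (sym (combine₂ (∣ y ∣ * ∣ y ∣) (∣∣-square x) (x * x) (∣∣-square y)
        (solve 4 (λ x y a b → a :* b :* (a :* b) :- x :* y :* (x :* y) :=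
            b :* b :* (a :* a :- x :* x) :+ x :* x :* (b :* b :- y :* y))
          refl x y ∣ x ∣ ∣ y ∣))))

  min-pos : ∀ {x y} → 0# < x → 0# < y → ∃[ z ] (0# < z × z ≤ x × z ≤ y)
  min-pos {x} {y} 0<x 0<y with <-or-≥ x y
  ... | inj₁ x<y = x , 0<x , ≤-refl , <⇒≤ x<y
  ... | inj₂ y≤x = y , 0<y , y≤x , ≤-refl

-- A local-to-global principle and differential calculus

module Analysis (em : ExcludedMiddle 0ℓ) (R : CompleteOrderedField) where
  open CompleteOrderedField R
  open IntegerSolver commutativeRing
  open OrderedField R

  -- The hypothesis of Cousin's lemma, restricted to intervals that contain `x`. For a `Q` that
  -- passes to unions of adjacent intervals it replaces compactness.
  LocallyTrue : (ℝ → ℝ → Set) → Set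
  LocallyTrue Q = ∀ x → ∃[ δ ] (0# < δ ×
    (∀ u v → u ≤ x → x ≤ v → x - δ < u → v < x + δ → Q u v))

  -- The supremum of the points reached from a cannot lie before b.
  local⇒global : (Q : ℝ → ℝ → Set) →
                 (∀ {u v w} → u ≤ v → v ≤ w → Q u v → Q v w → Q u w) →
                 LocallyTrue Q → ∀ {a b} → a ≤ b → Q a b
  local⇒global Q glue local {a} {b} a≤b = result
    where
    x<x+δ : ∀ {x δ} → 0# < δ → x < x + δ
    x<x+δ {x} {δ} 0<δ = <-from-difference 0<δ (solve 2 (λ x δ → x :+ δ :- x := δ) refl x δ)

    x-δ<x : ∀ {x δ} → 0# < δ → x - δ < x
    x-δ<x {x} {δ} 0<δ = <-from-difference 0<δ (solve 2 (λ x δ → x :- (x :- δ) := δ) refl x δ)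

    Reached : ℝ → Set
    Reached x = a ≤ x × x ≤ b × Q a x

    a-reached : Reached a
    a-reached with local a
    ... | δ , 0<δ , near = ≤-refl , a≤b , near a a ≤-refl ≤-refl (x-δ<x 0<δ) (x<x+δ 0<δ)

    result : Q a b
    result with complete Reached (a , a-reached) (b , λ _ x-reached → proj₁ (proj₂ x-reached))
    ... | s , s-bound , s-least with local s
    ... | δ , 0<δ , near with em {∃[ x ] (Reached x × s - δ < x)}
    -- Without a reached point in (s - δ, s], `s - δ` would be a smaller upper bound.
    ... | no none = ⊥-elim (<⇒≱ (x-δ<x 0<δ) (s-least (s - δ) bound))
      where
      bound : IsUpperBound Reached (s - δ)
      bound x x-reached with <-or-≥ (s - δ) x
      ... | inj₁ s-δ<x = ⊥-elim (none (x , x-reached , s-δ<x))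
      ... | inj₂ x≤s-δ = x≤s-δ
    ... | yes (x , x-reached@(a≤x , _ , Qax) , s-δ<x) with <-or-≥ b (s + δ)
    ...   | inj₁ b<s+δ = glue a≤x (≤-trans x≤s s≤b) Qax (near x b x≤s s≤b s-δ<x b<s+δ)
      where
      x≤s = s-bound x x-reached
      s≤b = s-least b (λ _ y-reached → proj₁ (proj₂ y-reached))
    -- The point halfway from `s` to `s + δ` would be reached too, beyond the supremum.
    ...   | inj₂ s+δ≤b = ⊥-elim (<⇒≱ s<v (s-bound v
              (≤-trans a≤x x≤v , <⇒≤ (<-≤-trans v<s+δ s+δ≤b) ,
               glue a≤x x≤v Qax (near x v x≤s (<⇒≤ s<v) s-δ<x v<s+δ))))
      where
      v = s + ½ * δ
      s<v = x<x+δ (half-pos 0<δ)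
      v<s+δ : v < s + δ
      v<s+δ = +-monoʳ-< s (half-< 0<δ)
      x≤s = s-bound x x-reached
      x≤v = ≤-trans x≤s (<⇒≤ s<v)

  -- Halves serve as the unit because increasing x by ½ turns the angle πx by a right angle.
  _·½ : ℕ → ℝ
  zero ·½  = 0#
  suc n ·½ = n ·½ + ½

  +-·½ : ∀ m n → (m ℕ.+ n) ·½ ≈ m ·½ + n ·½
  +-·½ zero n    = sym (+-identityˡ _)
  +-·½ (suc m) n = trans (+-congʳ (+-·½ m n))
    (solve 3 (λ a b h → a :+ b :+ h := a :+ h :+ b) refl (m ·½) (n ·½) ½)

  -- The numbers of halves that cover two adjacent intervals add up, so the local-to-global
  -- principle applies.
  archimedean : ∀ {x} → 0# ≤ x → ∃[ n ] x ≤ n ·½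
  archimedean {x} 0≤x = proj₁ covered ,
    ≤-respˡ (solve 1 (λ x → x :- :0 := x) refl x) (proj₂ covered)
    where
    Covered : ℝ → ℝ → Set
    Covered u v = ∃[ n ] v - u ≤ n ·½

    glue : ∀ {u v w} → u ≤ v → v ≤ w → Covered u v → Covered v w → Covered u w
    glue {u} {v} {w} _ _ (m , v-u≤m) (n , w-v≤n) = m ℕ.+ n ,
      ≤-respˡ (solve 3 (λ u v w → (v :- u) :+ (w :- v) := w :- u) refl u v w)
        (≤-respʳ (sym (+-·½ m n)) (+-mono-≤ v-u≤m w-v≤n))

    local : LocallyTrue Covered
    -- A quarter on either side of `x` keeps `v - u` below ½, so one half suffices.
    local x = ½ * ½ , half-pos 0<½ , λ u v _ _ x-δ<u v<x+δ → 1 ,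
      <⇒≤ (<-from-difference (+-pos (0<difference x-δ<u) (0<difference v<x+δ))
        (combine₁ (- ½) 2*½
          (solve 4 (λ x u v h → (:0 :+ h :- (v :- u)) :- ((u :- (x :- h :* h)) :+ (x :+ h :* h :- v))
              := :- h :* (:2 :* h :- :1)) refl x u v ½)))

    covered : Covered 0# x
    covered = local⇒global Covered glue local 0≤x

  -- φ h = o(h) as h → 0
  record Negligible (φ : ℝ → ℝ) : Set where
    constructor negligible
    field
      bound : ∀ ε → 0# < ε → ∃[ δ ] (0# < δ × (∀ h → ∣ h ∣ < δ → ∣ φ h ∣ ≤ ε * ∣ h ∣))

  record Vanishing (φ : ℝ → ℝ) : Set where
    constructor vanishing
    field
      bound : ∀ ε → 0# < ε → ∃[ δ ] (0# < δ × (∀ h → ∣ h ∣ < δ → ∣ φ h ∣ < ε))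

  record LinearlyBounded (B : ℝ) (φ : ℝ → ℝ) : Set where
    constructor linearlyBounded
    field
      bound : ∃[ δ ] (0# < δ × (∀ h → ∣ h ∣ < δ → ∣ φ h ∣ ≤ B * ∣ h ∣))

  negligible-cong : ∀ {φ ψ} → (∀ h → φ h ≈ ψ h) → Negligible φ → Negligible ψ
  negligible-cong {φ} {ψ} φ≈ψ (negligible small) = negligible λ ε 0<ε →
    let δ , 0<δ , bound = small ε 0<ε
    in δ , 0<δ , λ h h<δ → ≤-respˡ (∣∣-cong (φ≈ψ h)) (bound h h<δ)

  negligible-+ : ∀ {φ ψ} → Negligible φ → Negligible ψ → Negligible (λ h → φ h + ψ h)
  negligible-+ {φ} {ψ} (negligible small) (negligible small′) = negligible λ ε 0<ε →
    let δ , 0<δ , bound = small (½ * ε) (half-pos 0<ε)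
        δ′ , 0<δ′ , bound′ = small′ (½ * ε) (half-pos 0<ε)
        η , 0<η , η≤δ , η≤δ′ = min-pos 0<δ 0<δ′
    in η , 0<η , λ h h<η → ≤-trans (∣∣-+ (φ h) (ψ h))
    (≤-respʳ (trans (sym (distribʳ ∣ h ∣ (½ * ε) (½ * ε))) (*-congʳ (½-halves ε)))
      (+-mono-≤ (bound h (<-≤-trans h<η η≤δ)) (bound′ h (<-≤-trans h<η η≤δ′))))

  -- O(h) times o(1) is o(h): near 0, `ψ` is brought below `ε / B`.
  negligible-* : ∀ {φ ψ} B → 0# < B → LinearlyBounded B φ → Vanishing ψ →
                 Negligible (λ h → φ h * ψ h)
  negligible-* {φ} {ψ} B 0<B (linearlyBounded (δ , 0<δ , bound)) (vanishing small) =
    negligible λ ε 0<ε →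
    let δ′ , 0<δ′ , bound′ = small (ε / B) (/-pos 0<ε 0<B)
        η , 0<η , η≤δ , η≤δ′ = min-pos 0<δ 0<δ′
    in η , 0<η , λ h h<η →
    ≤-respˡ (sym (∣∣-* (φ h) (ψ h)))
      (≤-respʳ (combine₁ ∣ h ∣ (/-cancel {ε} (>⇒≉ 0<B))
          (solve 4 (λ B k e ε → B :* k :* e :- ε :* k := k :* (B :* e :- ε)) refl B ∣ h ∣ (ε / B) ε))
        (*-mono-≤ (∣∣-nonneg (φ h)) (∣∣-nonneg (ψ h))
          (bound h (<-≤-trans h<η η≤δ)) (<⇒≤ (bound′ h (<-≤-trans h<η η≤δ′)))))

  ∣x∣+1-pos : ∀ x → 0# < ∣ x ∣ + 1#
  ∣x∣+1-pos x = +-nonneg-pos (∣∣-nonneg x) 0<1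

  negligible-scale : ∀ {φ} c → Negligible φ → Negligible (λ h → c * φ h)
  negligible-scale {φ} c (negligible small) = negligible λ ε 0<ε →
    let δ , 0<δ , bound = small (ε / B) (/-pos 0<ε 0<B)
    in δ , 0<δ , λ h h<δ →
    ≤-respˡ (sym (∣∣-* c (φ h)))
      (≤-respʳ (combine₁ ∣ h ∣ (/-cancel {ε} (>⇒≉ 0<B))
          (solve 4 (λ B k e ε → B :* (e :* k) :- ε :* k := k :* (B :* e :- ε)) refl B ∣ h ∣ (ε / B) ε))
        (*-mono-≤ (∣∣-nonneg c) (∣∣-nonneg (φ h)) c≤B (bound h h<δ)))
    where
    -- The summand 1 keeps the divisor positive when `c` vanishes.
    B = ∣ c ∣ + 1#
    0<B = ∣x∣+1-pos c
    c≤B : ∣ c ∣ ≤ B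
    c≤B = ≤-from-difference (<⇒≤ 0<1) (solve 1 (λ a → a :+ :1 :- a := :1) refl ∣ c ∣)

  record HasDerivativeAt (f : ℝ → ℝ) (x d : ℝ) : Set where
    constructor differentiable
    field
      remainder : Negligible (λ h → (f (x + h) - f x) - d * h)

  derivative-at : ∀ {f f′} → HasDerivative f f′ → ∀ x → HasDerivativeAt f x (f′ x)
  derivative-at f′ x = differentiable (negligible (f′ x))

  -- Tolerance 1 in the definition of the derivative bounds the increment by ∣d∣∣h∣ + ∣h∣.
  increment-bounded : ∀ {f x d} → HasDerivativeAt f x d →
    LinearlyBounded (∣ d ∣ + 1#) (λ h → f (x + h) - f x)
  increment-bounded {f} {x} {d} (differentiable (negligible small)) = linearlyBounded (
    let δ , 0<δ , bound = small 1# 0<1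
    in δ , 0<δ , λ h h<δ →
    ≤-respˡ (∣∣-cong (solve 2 (λ a b → b :+ (a :- b) := a) refl (f (x + h) - f x) (d * h)))
      (≤-trans (∣∣-+ (d * h) _)
        (≤-respʳ (sym (distribʳ ∣ h ∣ ∣ d ∣ 1#)) (+-mono-≤ (inj₂ (∣∣-* d h)) (bound h h<δ)))))

  increment-vanishes : ∀ {f x d} → HasDerivativeAt f x d → Vanishing (λ h → f (x + h) - f x)
  increment-vanishes {f} {x} {d} f′ = vanishing λ ε 0<ε →
    let δ , 0<δ , bound = LinearlyBounded.bound (increment-bounded f′)
        η , 0<η , η≤δ , η≤ε/B = min-pos 0<δ (/-pos 0<ε 0<B)
    in η , 0<η , λ h h<η → ≤-<-trans (bound h (<-≤-trans h<η η≤δ))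
    (<-respʳ (/-cancel {ε} (>⇒≉ 0<B))
      (<-from-difference (*-pos 0<B (0<difference (<-≤-trans h<η η≤ε/B)))
        (solve 3 (λ b x y → b :* y :- b :* x := b :* (y :- x)) refl (∣ d ∣ + 1#) ∣ h ∣ (ε / (∣ d ∣ + 1#)))))
    where 0<B = ∣x∣+1-pos d

  -- The increment of the product is g Δf + f Δg + Δf Δg. The last term is negligible since Δf is
  -- O(h) and Δg tends to 0.
  derivative-* : ∀ {f g x d e} → HasDerivativeAt f x d → HasDerivativeAt g x e →
                 HasDerivativeAt (λ y → f y * g y) x (d * g x + f x * e)
  derivative-* {f} {g} {x} {d} {e} f′@(differentiable r) g′@(differentiable s) =
    differentiable (negligible-cong
      (λ h → solve 7 (λ F G f g d e h →
          g :* ((F :- f) :- d :* h) :+ f :* ((G :- g) :- e :* h) :+ (F :- f) :* (G :- g) :=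
          (F :* G :- f :* g) :- (d :* g :+ f :* e) :* h)
        refl (f (x + h)) (g (x + h)) (f x) (g x) d e h)
      (negligible-+
        (negligible-+ (negligible-scale (g x) r) (negligible-scale (f x) s))
        (negligible-* (∣ d ∣ + 1#) (∣x∣+1-pos d)
          (increment-bounded f′) (increment-vanishes g′))))

  derivative-+ : ∀ {f g x d e} → HasDerivativeAt f x d → HasDerivativeAt g x e →
                 HasDerivativeAt (λ y → f y + g y) x (d + e)
  derivative-+ {f} {g} {x} {d} {e} (differentiable r) (differentiable s) =
    differentiable (negligible-cong
      (λ h → solve 7 (λ F G f g d e h →
          ((F :- f) :- d :* h) :+ ((G :- g) :- e :* h) := (F :+ G :- (f :+ g)) :- (d :+ e) :* h)
        refl (f (x + h)) (g (x + h)) (f x) (g x) d e h)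
      (negligible-+ r s))

  derivative-neg : ∀ {f x d} → HasDerivativeAt f x d → HasDerivativeAt (λ y → - f y) x (- d)
  derivative-neg {f} {x} {d} (differentiable r) =
    differentiable (negligible-cong
      (λ h → solve 4 (λ F f d h → :- :1 :* ((F :- f) :- d :* h) := (:- F :- :- f) :- :- d :* h)
        refl (f (x + h)) (f x) d h)
      (negligible-scale (- 1#) r))

  derivative-cong : ∀ {f x d e} → d ≈ e → HasDerivativeAt f x d → HasDerivativeAt f x e
  derivative-cong d≈e (differentiable r) =
    differentiable (negligible-cong (λ h → +-congˡ (-‿cong (*-congʳ d≈e))) r)

  derivative-shift : ∀ {f d} → (∀ {x y} → x ≈ y → f x ≈ f y) → ∀ a {x} →
                     HasDerivativeAt f (a + x) d → HasDerivativeAt (λ y → f (a + y)) x d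
  derivative-shift f-cong a {x} (differentiable r) = differentiable
    (negligible-cong (λ h → +-congʳ (+-congʳ (f-cong (+-assoc a x h)))) r)

  ≤ε⇒≤0 : ∀ {x c} → 0# ≤ c → (∀ ε → 0# < ε → x ≤ ε * c) → x ≤ 0#
  ≤ε⇒≤0 {x} {c} 0≤c small with <-or-≥ 0# x
  ... | inj₂ x≤0 = x≤0
  ... | inj₁ 0<x = ⊥-elim (<⇒≱ εc<x (small ε 0<ε))
    where
    0<c+1 = +-nonneg-pos 0≤c 0<1
    ε = x / (c + 1#)
    0<ε = /-pos 0<x 0<c+1
    εc<x : ε * c < x
    εc<x = <-from-difference 0<ε (combine₁ (- 1#) (/-cancel {x} (>⇒≉ 0<c+1))
      (solve 3 (λ x c e → x :- e :* c :- e := :- :1 :* ((c :+ :1) :* e :- x)) refl x c ε))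

  -- For each ε > 0 the bound ∣f v - f u∣ ≤ ε (v - u) holds on small intervals around any point, by
  -- comparing both ends with that point, and it adds up over adjacent intervals. Hence it holds
  -- from `a` to `b` for every ε.
  zero-derivative⇒≤-constant : ∀ {f} → (∀ {x y} → x ≈ y → f x ≈ f y) →
    (∀ x → HasDerivativeAt f x 0#) → ∀ {a b} → a ≤ b → f a ≈ f b
  zero-derivative⇒≤-constant {f} f-cong f′ {a} {b} a≤b =
    sym (≈-from-difference (≤-antisym
      (≤-trans (x≤∣x∣ _) ∣Δ∣≤0)
      (≤-respʳ (solve 1 (λ x → :- :- x := x) refl _)
        (neg-nonneg (≤-trans (-x≤∣x∣ _) ∣Δ∣≤0)))))
    where
    local : ∀ ε → 0# < ε → LocallyTrue (λ u v → ∣ f v - f u ∣ ≤ ε * (v - u))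
    local ε 0<ε x = δ , 0<δ , near
      where
      estimate = Negligible.bound (HasDerivativeAt.remainder (f′ x)) ε 0<ε
      δ = proj₁ estimate
      0<δ = proj₁ (proj₂ estimate)
      bound = proj₂ (proj₂ estimate)
      step : ∀ y → ∣ y - x ∣ < δ → ∣ f y - f x ∣ ≤ ε * ∣ y - x ∣
      step y y-x<δ = ≤-respˡ
        (∣∣-cong (trans
          (solve 3 (λ F f h → (F :- f) :- :0 :* h := F :- f) refl (f (x + (y - x))) (f x) (y - x))
          (+-congʳ (f-cong (solve 2 (λ x y → x :+ (y :- x) := y) refl x y)))))
        (bound (y - x) y-x<δ)
      near : ∀ u v → u ≤ x → x ≤ v → x - δ < u → v < x + δ → ∣ f v - f u ∣ ≤ ε * (v - u)
      near u v u≤x x≤v x-δ<u v<x+δ =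
        ≤-respˡ (∣∣-cong (solve 3 (λ a b c → (c :- a) :+ :- (b :- a) := c :- b) refl (f x) (f u) (f v)))
          (≤-trans (∣∣-+ _ _)
            (≤-respʳ (trans (+-cong (*-congˡ (0≤x⇒∣x∣≈x (0≤difference x≤v)))
                                    (*-congˡ (trans (sym (∣-x∣≈∣x∣ (u - x)))
                                               (trans (∣∣-cong swap) (0≤x⇒∣x∣≈x (0≤difference u≤x))))))
                            (solve 4 (λ e x u v → e :* (v :- x) :+ e :* (x :- u) := e :* (v :- u))
                              refl ε x u v))
              (+-mono-≤
                (step v (∣∣-<
                  (<-from-difference (0<difference v<x+δ)
                    (solve 3 (λ v x d → d :- (v :- x) := x :+ d :- v) refl v x δ))
                  (<-from-difference (+-pos-nonneg 0<δ (0≤difference x≤v))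
                    (solve 3 (λ v x d → d :- :- (v :- x) := d :+ (v :- x)) refl v x δ))))
                (≤-respˡ (sym (∣-x∣≈∣x∣ _))
                  (step u (∣∣-<
                    (<-from-difference (+-pos-nonneg 0<δ (0≤difference u≤x))
                      (solve 3 (λ u x d → d :- (u :- x) := d :+ (x :- u)) refl u x δ))
                    (<-from-difference (0<difference x-δ<u)
                      (solve 3 (λ u x d → d :- :- (u :- x) := u :- (x :- d)) refl u x δ))))))))
        where
        swap : - (u - x) ≈ x - u
        swap = solve 2 (λ u x → :- (u :- x) := x :- u) refl u x
    glue : ∀ ε {u v w} → u ≤ v → v ≤ w → ∣ f v - f u ∣ ≤ ε * (v - u) →
           ∣ f w - f v ∣ ≤ ε * (w - v) → ∣ f w - f u ∣ ≤ ε * (w - u)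
    glue ε {u} {v} {w} _ _ p q =
      ≤-respˡ (∣∣-cong (solve 3 (λ a b c → (b :- a) :+ (c :- b) := c :- a) refl (f u) (f v) (f w)))
        (≤-trans (∣∣-+ _ _)
          (≤-respʳ (solve 4 (λ e u v w → e :* (v :- u) :+ e :* (w :- v) := e :* (w :- u)) refl ε u v w)
            (+-mono-≤ p q)))
    ∣Δ∣≤0 : ∣ f b - f a ∣ ≤ 0#
    ∣Δ∣≤0 = ≤ε⇒≤0 (0≤difference a≤b) (λ ε 0<ε →
      local⇒global (λ u v → ∣ f v - f u ∣ ≤ ε * (v - u)) (glue ε) (local ε 0<ε) a≤b)

  zero-derivative⇒constant : ∀ {f} → (∀ {x y} → x ≈ y → f x ≈ f y) →
    (∀ x → HasDerivativeAt f x 0#) → ∀ a b → f a ≈ f b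
  zero-derivative⇒constant f-cong f′ a b with <-or-≥ a b
  ... | inj₁ a<b = zero-derivative⇒≤-constant f-cong f′ (<⇒≤ a<b)
  ... | inj₂ b≤a = sym (zero-derivative⇒≤-constant f-cong f′ b≤a)

-- Sine, cosine and π from their differential equations

module SinCos (em : ExcludedMiddle 0ℓ) (R : CompleteOrderedField) (T : Trigonometry R) where
  open CompleteOrderedField R
  open Trigonometry T
  open IntegerSolver commutativeRing
  open OrderedField R
  open Analysis em R

  sin-derivative : ∀ x → HasDerivativeAt sin x (cos x)
  sin-derivative = derivative-at sin′

  cos-derivative : ∀ x → HasDerivativeAt cos x (- sin x)
  cos-derivative = derivative-at cos′

  record Oscillation (f g : ℝ → ℝ) : Set where
    field
      f-cong : ∀ {x y} → x ≈ y → f x ≈ f y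
      g-cong : ∀ {x y} → x ≈ y → g x ≈ g y
      f′     : ∀ x → HasDerivativeAt f x (g x)
      g′     : ∀ x → HasDerivativeAt g x (- f x)

  -- The inner product of two trajectories in the phase plane, where both rotate at the same speed.
  -- The pairs (sin, cos), (cos, -sin) and the translates of (sin, cos) yield Pythagoras and the
  -- addition formulas.
  conserved : ∀ {f g u v} → Oscillation f g → Oscillation u v →
              ∀ a b → f a * u a + g a * v a ≈ f b * u b + g b * v b
  conserved {f} {g} {u} {v} F U = zero-derivative⇒constant
    (λ x≈y → +-cong (*-cong (F.f-cong x≈y) (U.f-cong x≈y)) (*-cong (F.g-cong x≈y) (U.g-cong x≈y)))
    (λ x → derivative-cong
      (solve 4 (λ f g u v → (g :* u :+ f :* v) :+ (:- f :* v :+ g :* :- u) := :0)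
        refl (f x) (g x) (u x) (v x))
      (derivative-+ (derivative-* (F.f′ x) (U.f′ x)) (derivative-* (F.g′ x) (U.g′ x))))
    where
    module F = Oscillation F
    module U = Oscillation U

  sin-cos : Oscillation sin cos
  sin-cos = record
    { f-cong = sin-cong ; g-cong = cos-cong ; f′ = sin-derivative ; g′ = cos-derivative }

  cos-neg-sin : Oscillation cos (λ x → - sin x)
  cos-neg-sin = record
    { f-cong = cos-cong
    ; g-cong = λ x≈y → -‿cong (sin-cong x≈y)
    ; f′     = cos-derivative
    ; g′     = λ x → derivative-neg (sin-derivative x)
    }

  shifted-sin-cos : ∀ a → Oscillation (λ x → sin (a + x)) (λ x → cos (a + x))
  shifted-sin-cos a = record
    { f-cong = λ x≈y → sin-cong (+-congˡ x≈y)
    ; g-cong = λ x≈y → cos-cong (+-congˡ x≈y)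
    ; f′     = λ x → derivative-shift sin-cong a (sin-derivative (a + x))
    ; g′     = λ x → derivative-shift cos-cong a (cos-derivative (a + x))
    }

  sin²+cos²≈1 : ∀ x → sin x * sin x + cos x * cos x ≈ 1#
  sin²+cos²≈1 x = trans (conserved sin-cos sin-cos x 0#)
    (trans (+-cong (*-cong sin-0 sin-0) (*-cong cos-0 cos-0))
      (solve 0 (:0 :* :0 :+ :1 :* :1 := :1) refl))

  cos-of-difference : ∀ a x → sin (a + x) * sin x + cos (a + x) * cos x ≈ cos a
  cos-of-difference a x = trans (conserved (shifted-sin-cos a) sin-cos x 0#)
    (trans (+-cong (*-congˡ sin-0) (*-cong (cos-cong (+-identityʳ a)) cos-0))
      (solve 2 (λ s c → s :* :0 :+ c :* :1 := c) refl (sin (a + 0#)) (cos a)))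

  sin-of-difference : ∀ a x → sin (a + x) * cos x + cos (a + x) * - sin x ≈ sin a
  sin-of-difference a x = trans (conserved (shifted-sin-cos a) cos-neg-sin x 0#)
    (trans (+-cong (*-cong (sin-cong (+-identityʳ a)) cos-0) (*-congˡ (-‿cong sin-0)))
      (solve 2 (λ s c → s :* :1 :+ c :* :- :0 := s) refl (sin a) (cos (a + 0#))))

  -- The two difference formulas are linear equations for sin (a + x) and cos (a + x). Their matrix
  -- is orthogonal by Pythagoras, so its transpose solves them.
  sin-+ : ∀ a x → sin (a + x) ≈ sin a * cos x + cos a * sin x
  sin-+ a x = combine₃ (- sin (a + x)) (sin²+cos²≈1 x)
    (cos x) (sin-of-difference a x) (sin x) (cos-of-difference a x)
    (solve 6 (λ s c S C sa ca → S :- (sa :* c :+ ca :* s) :=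
        :- S :* (s :* s :+ c :* c :- :1) :+ c :* (S :* c :+ C :* :- s :- sa)
          :+ s :* (S :* s :+ C :* c :- ca))
      refl (sin x) (cos x) (sin (a + x)) (cos (a + x)) (sin a) (cos a))

  cos-+ : ∀ a x → cos (a + x) ≈ cos a * cos x - sin a * sin x
  cos-+ a x = combine₃ (- cos (a + x)) (sin²+cos²≈1 x)
    (- sin x) (sin-of-difference a x) (cos x) (cos-of-difference a x)
    (solve 6 (λ s c S C sa ca → C :- (ca :* c :- sa :* s) :=
        :- C :* (s :* s :+ c :* c :- :1) :+ :- s :* (S :* c :+ C :* :- s :- sa)
          :+ c :* (S :* s :+ C :* c :- ca))
      refl (sin x) (cos x) (sin (a + x)) (cos (a + x)) (sin a) (cos a))

  -- The addition formulas at x + (-x) = 0 are linear equations for sin (-x) and cos (-x), again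
  -- with an orthogonal matrix.
  sin-neg : ∀ x → sin (- x) ≈ - sin x
  sin-neg x = combine₃ (- sin (- x)) (sin²+cos²≈1 x)
    (cos x) (trans (sym (sin-+ x (- x))) (trans (sin-cong (-‿inverseʳ x)) sin-0))
    (- sin x) (trans (sym (cos-+ x (- x))) (trans (cos-cong (-‿inverseʳ x)) cos-0))
    (solve 4 (λ s c s′ c′ → s′ :- :- s :=
        :- s′ :* (s :* s :+ c :* c :- :1) :+ c :* (s :* c′ :+ c :* s′ :- :0)
          :+ :- s :* (c :* c′ :- s :* s′ :- :1))
      refl (sin x) (cos x) (sin (- x)) (cos (- x)))

  ∣sin∣≤1 : ∀ x → ∣ sin x ∣ ≤ 1#
  ∣sin∣≤1 x with <-or-≥ 1# ∣ sin x ∣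
  ... | inj₂ ≤1 = ≤1
  -- The product is (∣sin x∣ + 1)(∣sin x∣ - 1) = sin² x - 1. Were it positive, adding cos² x could
  -- not give 0.
  ... | inj₁ 1<s = ⊥-elim (<⇒≱ (+-pos-nonneg
          (*-pos (+-pos-nonneg (0<difference 1<s) (<⇒≤ 0<2)) (0<difference 1<s))
          (square-nonneg (cos x)))
          (inj₂ (combine₂ 1# (sin²+cos²≈1 x) 1# (∣∣-square (sin x))
            (solve 3 (λ a s c → (a :- :1 :+ :2) :* (a :- :1) :+ c :* c :- :0 :=
                :1 :* (s :* s :+ c :* c :- :1) :+ :1 :* (a :* a :- s :* s))
              refl ∣ sin x ∣ (sin x) (cos x)))))

  π/2<π : π / 2# < π
  π/2<π = <-respˡ (*-comm ½ π) (half-< 0<π)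

  0<π/2 : 0# < π / 2#
  0<π/2 = /-pos 0<π 0<2

  π/2+π/2 : π / 2# + π / 2# ≈ π
  π/2+π/2 = trans (+-cong (*-comm π ½) (*-comm π ½)) (½-halves π)

  sin≉0 : ∀ {x} → 0# < x → x < π → sin x ≉ 0#
  sin≉0 0<x x<π sin≈0 = <⇒≱ x<π (π-least _ 0<x sin≈0)

  -- The derivative at 0 is 1, so tolerance ½ leaves sin h ≥ h / 2 for small positive h.
  sin-pos-near-0 : ∃[ δ ] (0# < δ × (∀ h → 0# < h → h < δ → 0# < sin h))
  sin-pos-near-0 =
    let δ , 0<δ , bound = sin′ 0# ½ 0<½
    in δ , 0<δ , λ h 0<h h<δ →
      let ∣h∣≈h = 0≤x⇒∣x∣≈x (<⇒≤ 0<h)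
          sin[0+h]≈sin[h] = sin-cong (+-identityˡ h)
          h-sin[h]≤½h : h - sin h ≤ ½ * h
          h-sin[h]≤½h = ≤-respˡ
            (combine₃ (- 1#) sin[0+h]≈sin[h] 1# sin-0 h cos-0
              (solve 5 (λ S s z c h → :- ((S :- z) :- c :* h) :- (h :- s) :=
                  :- :1 :* (S :- s) :+ :1 :* (z :- :0) :+ h :* (c :- :1))
                refl (sin (0# + h)) (sin h) (sin 0#) (cos 0#) h))
            (≤-trans (-x≤∣x∣ _)
              (≤-respʳ (*-congˡ ∣h∣≈h) (bound h (<-respˡ (sym ∣h∣≈h) h<δ))))
      in <-from-difference (+-nonneg-pos (0≤difference h-sin[h]≤½h) (half-pos 0<h))
           (combine₁ (- h) 2*½
             (solve 3 (λ s h i → s :- :0 :- (i :* h :- (h :- s) :+ i :* h) := :- h :* (:2 :* i :- :1))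
               refl (sin h) h ½))

  -- A continuous function without zeros on (0, π) keeps its sign there. The bounds are premises
  -- inside `Preserved`, which makes it vacuous around points outside (0, π).
  sin-sign-preserved : ∀ {u v} → u ≤ v → 0# < u → v < π → 0# < sin u → 0# < sin v
  sin-sign-preserved = local⇒global Preserved
    (λ u≤v v≤w p q 0<u w<π 0<sinu →
      q (<-≤-trans 0<u u≤v) w<π (p 0<u (≤-<-trans v≤w w<π) 0<sinu))
    local
    where
    Preserved : ℝ → ℝ → Set
    Preserved u v = 0# < u → v < π → 0# < sin u → 0# < sin v

    local : LocallyTrue Preserved
    local x with <-or-≥ 0# x | <-or-≥ x π
    ... | inj₂ x≤0 | _ = 1# , 0<1 , λ u v u≤x _ _ _ 0<u → ⊥-elim (<⇒≱ 0<u (≤-trans u≤x x≤0))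
    ... | inj₁ _ | inj₂ π≤x = 1# , 0<1 , λ u v _ x≤v _ _ _ v<π → ⊥-elim (<⇒≱ v<π (≤-trans π≤x x≤v))
    ... | inj₁ 0<x | inj₁ x<π with compare (sin x) 0#
    ...   | tri≈ _ sin≈0 _ = ⊥-elim (sin≉0 0<x x<π sin≈0)
    ...   | tri> _ _ 0<sin =
      let δ , 0<δ , bound = Vanishing.bound (increment-vanishes (sin-derivative x)) (sin x) 0<sin
      in δ , 0<δ , λ u v u≤x x≤v _ v<x+δ _ _ _ →
        let ∣h∣<δ : ∣ v - x ∣ < δ
            ∣h∣<δ = <-respˡ (sym (0≤x⇒∣x∣≈x (0≤difference x≤v)))
              (<-from-difference (0<difference v<x+δ)
                (solve 3 (λ v x d → d :- (v :- x) := x :+ d :- v) refl v x δ))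
        in <-from-difference
             (0<difference (≤-<-trans (-x≤∣x∣ (sin (x + (v - x)) - sin x)) (bound (v - x) ∣h∣<δ)))
             (combine₁ (- 1#) (sin-cong (solve 2 (λ x v → x :+ (v :- x) := v) refl x v))
               (solve 3 (λ S s z → s :- :0 :- (z :- :- (S :- z)) := :- :1 :* (S :- s))
                 refl (sin (x + (v - x))) (sin v) (sin x)))
    -- Here the sine is negative near `x`, which refutes the premise on `u`.
    ...   | tri< sin<0 _ _ =
      let δ , 0<δ , bound = Vanishing.bound (increment-vanishes (sin-derivative x)) (- sin x) (neg-pos sin<0)
      in δ , 0<δ , λ u v u≤x _ x-δ<u _ _ _ 0<sinu →
        let ∣h∣<δ : ∣ u - x ∣ < δ
            ∣h∣<δ = ∣∣-<
              (<-from-difference (+-pos-nonneg 0<δ (0≤difference u≤x))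
                (solve 3 (λ u x d → d :- (u :- x) := d :+ (x :- u)) refl u x δ))
              (<-from-difference (0<difference x-δ<u)
                (solve 3 (λ u x d → d :- :- (u :- x) := u :- (x :- d)) refl u x δ))
            sinu<0 : sin u < 0#
            sinu<0 = <-from-difference
              (0<difference (≤-<-trans (x≤∣x∣ (sin (x + (u - x)) - sin x)) (bound (u - x) ∣h∣<δ)))
              (combine₁ 1# (sin-cong (solve 2 (λ x v → x :+ (v :- x) := v) refl x u))
                (solve 3 (λ S s z → :0 :- s :- (:- z :- (S :- z)) := :1 :* (S :- s))
                  refl (sin (x + (u - x))) (sin u) (sin x)))
        in ⊥-elim (<⇒≱ 0<sinu (<⇒≤ sinu<0))

  sin-pos : ∀ {x} → 0# < x → x < π → 0# < sin x
  sin-pos {x} 0<x x<π =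
    let δ , 0<δ , near = sin-pos-near-0
        η , 0<η , η≤x , η≤δ = min-pos 0<x 0<δ
        u = ½ * η
        u<η = half-< 0<η
        0<u = half-pos 0<η
    in sin-sign-preserved (≤-trans (<⇒≤ u<η) η≤x) 0<u x<π (near u 0<u (<-≤-trans u<η η≤δ))

  sin-nonneg : ∀ {x} → 0# ≤ x → x ≤ π → 0# ≤ sin x
  sin-nonneg (inj₂ 0≈x) _          = inj₂ (trans (sym sin-0) (sin-cong 0≈x))
  sin-nonneg (inj₁ _)   (inj₂ x≈π) = inj₂ (trans (sym sin-π) (sin-cong (sym x≈π)))
  sin-nonneg (inj₁ 0<x) (inj₁ x<π) = inj₁ (sin-pos 0<x x<π)

  -- From 0 = sin π = 2 sin (π/2) cos (π/2), where sin (π/2) does not vanish because π is the least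
  -- positive zero.
  cos-π/2 : cos (π / 2#) ≈ 0#
  cos-π/2 = x*y≈0⇒y≈0 {2# * sin (π / 2#)} (*-≉0 2≉0 (sin≉0 0<π/2 π/2<π))
    (trans (solve 2 (λ s c → :2 :* s :* c := s :* c :+ c :* s) refl (sin (π / 2#)) (cos (π / 2#)))
      (trans (sym (sin-+ (π / 2#) (π / 2#))) (trans (sin-cong π/2+π/2) sin-π)))

  sin-π/2 : sin (π / 2#) ≈ 1#
  sin-π/2 = square-injective (<⇒≤ (sin-pos 0<π/2 π/2<π)) (<⇒≤ 0<1)
    (combine₂ 1# (sin²+cos²≈1 (π / 2#)) (- cos (π / 2#)) cos-π/2
      (solve 2 (λ s c → s :* s :- :1 :* :1 := :1 :* (s :* s :+ c :* c :- :1) :+ :- c :* (c :- :0))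
        refl (sin (π / 2#)) (cos (π / 2#))))

  sin-+π/2 : ∀ x → sin (x + π / 2#) ≈ cos x
  sin-+π/2 x = trans (sin-+ x (π / 2#))
    (combine₂ (sin x) cos-π/2 (cos x) sin-π/2
      (solve 4 (λ s c s′ c′ → s :* c′ :+ c :* s′ :- c := s :* (c′ :- :0) :+ c :* (s′ :- :1))
        refl (sin x) (cos x) (sin (π / 2#)) (cos (π / 2#))))

  cos-nonneg : ∀ {x} → 0# ≤ x → x ≤ π / 2# → 0# ≤ cos x
  cos-nonneg {x} 0≤x x≤π/2 = ≤-respʳ (sin-+π/2 x)
    (sin-nonneg (+-nonneg 0≤x (<⇒≤ 0<π/2)) (≤-respʳ π/2+π/2 (+-mono-≤ x≤π/2 ≤-refl)))

-- Lines and circles with obtainable equations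

module Coordinates (R : CompleteOrderedField) (T : Trigonometry R) where
  open CompleteOrderedField R
  open IntegerSolver commutativeRing
  open OrderedField R
  open Constructions R T

  module ObtainableLoci (_↦_ : ℝ → ℝ → Set) where

    O : ℝ → Set
    O = Obtainable _↦_

    O² : Point → Set
    O² (x , y) = O x × O y

    O-0 : O 0#
    O-0 = resp (-‿inverseʳ 1#) (sub one one)

    O-2 : O 2#
    O-2 = add one one

    O-neg : ∀ {x} → O x → O (- x)
    O-neg Ox = resp (+-identityˡ _) (sub O-0 Ox)

    O-quotient : ∀ {d n x} → O d → d ≉ 0# → O n → d * x ≈ n → O x
    O-quotient {d} {n} {x} Od d≉0 On dx≈n =
      resp (*-cancelˡ d≉0 (trans (/-cancel d≉0) (sym dx≈n))) (div On Od d≉0)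

    -- `sqrt` returns only the nonnegative root of a positive number; zero and negative roots come
    -- from 0 and negation.
    O-root : ∀ {x} → O (x * x) → O x
    O-root {x} Oxx with compare x 0#
    ... | tri≈ _ x≈0 _ = resp (sym x≈0) O-0
    ... | tri> _ x≉0 0<x = sqrt Oxx (square-pos x≉0) (<⇒≤ 0<x , refl)
    ... | tri< x<0 x≉0 _ = resp (solve 1 (λ x → :- :- x := x) refl x)
            (O-neg (sqrt Oxx (square-pos x≉0)
              (<⇒≤ (neg-pos x<0) , solve 1 (λ x → :- x :* :- x := x :* x) refl x)))

    O-length : ∀ {P Q ℓ} → O² P → O² Q → HasLength P Q ℓ → O ℓ
    O-length (Oa , Ob) (Oc , Od) (_ , ℓℓ≈) =
      O-root (resp (sym ℓℓ≈) (add (mul (sub Oc Oa) (sub Oc Oa)) (mul (sub Od Ob) (sub Od Ob))))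

    -- Both directions are recorded because `Distinct` compares loci as sets of points: proportional
    -- equations must yield equal loci.
    record Linear (S : Point → Set) : Set where
      field
        α β γ     : ℝ
        Oα        : O α
        Oβ        : O β
        Oγ        : O γ
        nontrivial : ¬ (α ≈ 0# × β ≈ 0#)
        equation  : ∀ x y → S (x , y) → α * x + β * y ≈ γ
        solution  : ∀ x y → α * x + β * y ≈ γ → S (x , y)

    record Circular (S : Point → Set) : Set where
      field
        a b c     : ℝ
        Oa        : O a
        Ob        : O b
        Oc        : O c
        equation  : ∀ x y → S (x , y) → x * x + y * y + a * x + b * y ≈ c
        solution  : ∀ x y → x * x + y * y + a * x + b * y ≈ c → S (x , y)

    Described : Figure → Set
    Described f = Linear (_on support f) ⊎ Circular (_on support f)

    on⇒on-support : ∀ {X} f → X on f → X on support f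
    on⇒on-support (line _ _)   on-f = on-f
    on⇒on-support (circle _ _) on-f = on-f
    on⇒on-support (ray _ _) (t , _ , e) = t , e

    parallel⇒⊆ : ∀ {α β γ α′ β′ γ′ x y} → ¬ (α ≈ 0# × β ≈ 0#) → α * β′ ≈ α′ * β →
                 α * x + β * y ≈ γ → α′ * x + β′ * y ≈ γ′ →
                 ∀ u v → α * u + β * v ≈ γ → α′ * u + β′ * v ≈ γ′
    parallel⇒⊆ {α} {β} {γ} {α′} {β′} {γ′} {x} {y} ¬0 det≈0 eq eq′ u v equv with ≈0-or-≉0 α
    ... | inj₂ α≉0 = trans (≈-from-difference (x*y≈0⇒y≈0 α≉0
            (combine₂ (v - y) det≈0 α′ (trans equv (sym eq))
              (solve 8 (λ α β α′ β′ x y u v →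
                  α :* (α′ :* u :+ β′ :* v :- (α′ :* x :+ β′ :* y)) :- :0 :=
                  (v :- y) :* (α :* β′ :- α′ :* β) :+ α′ :* (α :* u :+ β :* v :- (α :* x :+ β :* y)))
                refl α β α′ β′ x y u v)))) eq′
    ... | inj₁ α≈0 = trans (≈-from-difference (x*y≈0⇒y≈0 {β} (λ β≈0 → ¬0 (α≈0 , β≈0))
            (combine₂ (x - u) det≈0 β′ (trans equv (sym eq))
              (solve 8 (λ α β α′ β′ x y u v →
                  β :* (α′ :* u :+ β′ :* v :- (α′ :* x :+ β′ :* y)) :- :0 :=
                  (x :- u) :* (α :* β′ :- α′ :* β) :+ β′ :* (α :* u :+ β :* v :- (α :* x :+ β :* y)))
                refl α β α′ β′ x y u v)))) eq′

    -- Cramer's rule. A vanishing determinant together with the common point would make the two loci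
    -- equal.
    linear∩linear : ∀ {S S′ x y} → Linear S → Linear S′ → ¬ (∀ X → S X ⇔ S′ X) →
                    S (x , y) → S′ (x , y) → O² (x , y)
    linear∩linear {x = x} {y} L L′ distinct Sxy S′xy 
      with ≈0-or-≉0 (Linear.α L * Linear.β L′ - Linear.α L′ * Linear.β L)
    ... | inj₁ det≈0 = ⊥-elim (distinct λ (u , v) → mk⇔
            (λ Suv → L′.solution u v (parallel⇒⊆ L.nontrivial (≈-from-difference det≈0)
              (L.equation x y Sxy) (L′.equation x y S′xy) u v (L.equation u v Suv)))
            (λ S′uv → L.solution u v (parallel⇒⊆ L′.nontrivial
              (sym (≈-from-difference det≈0))
              (L′.equation x y S′xy) (L.equation x y Sxy) u v (L′.equation u v S′uv))))
      where
      module L = Linear L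
      module L′ = Linear L′
    ... | inj₂ det≉0 =
            O-quotient Odet det≉0 (sub (mul L.Oγ L′.Oβ) (mul L′.Oγ L.Oβ))
              (combine₂ L′.β (L.equation x y Sxy) (- L.β) (L′.equation x y S′xy)
                (solve 8 (λ α β γ α′ β′ γ′ x y →
                    (α :* β′ :- α′ :* β) :* x :- (γ :* β′ :- γ′ :* β) :=
                    β′ :* (α :* x :+ β :* y :- γ) :+ :- β :* (α′ :* x :+ β′ :* y :- γ′))
                  refl L.α L.β L.γ L′.α L′.β L′.γ x y)) ,
            O-quotient Odet det≉0 (sub (mul L.Oα L′.Oγ) (mul L′.Oα L.Oγ))
              (combine₂ (- L′.α) (L.equation x y Sxy) L.α (L′.equation x y S′xy)
                (solve 8 (λ α β γ α′ β′ γ′ x y →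
                    (α :* β′ :- α′ :* β) :* y :- (α :* γ′ :- α′ :* γ) :=
                    :- α′ :* (α :* x :+ β :* y :- γ) :+ α :* (α′ :* x :+ β′ :* y :- γ′))
                  refl L.α L.β L.γ L′.α L′.β L′.γ x y))
      where
      module L = Linear L
      module L′ = Linear L′
      Odet = sub (mul L.Oα L′.Oβ) (mul L′.Oα L.Oβ)

    -- With N = α² + β², the coordinate s = βx − αy along the line satisfies the
    -- monic quadratic s² + ks + m = 0, so that (2s + k)² = k² − 4m is obtainable.
    line-equation∩circle-equation : ∀ {α β γ a b c x y} →
      O α → O β → O γ → ¬ (α ≈ 0# × β ≈ 0#) → O a → O b → O c →
      α * x + β * y ≈ γ → x * x + y * y + a * x + b * y ≈ c → O² (x , y)
    line-equation∩circle-equation {α} {β} {γ} {a} {b} {c} {x} {y} Oα Oβ Oγ ¬0 Oa Ob Oc eqL eqC =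
      O-quotient ON N≉0 (add (mul Oα Oγ) (mul Oβ Os))
        (combine₁ α eqL (solve 5 (λ α β γ x y →
            (α :* α :+ β :* β) :* x :- (α :* γ :+ β :* (β :* x :- α :* y)) :=
            α :* (α :* x :+ β :* y :- γ)) refl α β γ x y)) ,
      O-quotient ON N≉0 (sub (mul Oβ Oγ) (mul Oα Os))
        (combine₁ β eqL (solve 5 (λ α β γ x y →
            (α :* α :+ β :* β) :* y :- (β :* γ :- α :* (β :* x :- α :* y)) :=
            β :* (α :* x :+ β :* y :- γ)) refl α β γ x y))
      where
      N = α * α + β * β
      ON = add (mul Oα Oα) (mul Oβ Oβ)
      N≉0 : N ≉ 0#
      N≉0 = >⇒≉ (squares-pos ¬0)
      s = β * x - α * y
      k = a * β - b * α
      Ok = sub (mul Oa Oβ) (mul Ob Oα)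
      m = γ * γ + a * α * γ + b * β * γ - c * N
      Om = sub (add (add (mul Oγ Oγ) (mul (mul Oa Oα) Oγ)) (mul (mul Ob Oβ) Oγ)) (mul Oc ON)
      quadratic : s * s + k * s + m ≈ 0#
      -- This is N times the circle's equation, rewritten by N (x² + y²) = s² + (αx + βy)² and N (ax
      -- + by) = ks + (aα + bβ)(αx + βy), with γ in place of αx + βy.
      quadratic = combine₂ N eqC
        (- (α * x + β * y + γ + a * α + b * β)) eqL
        (solve 8 (λ α β γ a b c x y →
            let s = β :* x :- α :* y
                k = a :* β :- b :* α
                N = α :* α :+ β :* β
                m = γ :* γ :+ a :* α :* γ :+ b :* β :* γ :- c :* N
            in s :* s :+ k :* s :+ m :- :0 :=
               N :* (x :* x :+ y :* y :+ a :* x :+ b :* y :- c)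
               :+ (:- (α :* x :+ β :* y :+ γ :+ a :* α :+ b :* β)) :* (α :* x :+ β :* y :- γ))
          refl α β γ a b c x y)
      O2s+k : O (2# * s + k)
      O2s+k = O-root (resp
        (sym (combine₁ (2# * 2#) quadratic
          (solve 3 (λ s k m → (:2 :* s :+ k) :* (:2 :* s :+ k) :- (k :* k :- :2 :* :2 :* m) :=
              :2 :* :2 :* (s :* s :+ k :* s :+ m :- :0)) refl s k m)))
        (sub (mul Ok Ok) (mul (mul O-2 O-2) Om)))
      Os : O s
      Os = O-quotient O-2 2≉0 (sub O2s+k Ok)
        (solve 2 (λ s k → :2 :* s := :2 :* s :+ k :- k) refl s k)

    linear∩circular : ∀ {S S′ x y} → Linear S → Circular S′ →
                      S (x , y) → S′ (x , y) → O² (x , y)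
    linear∩circular {x = x} {y} L C Sxy S′xy =
      line-equation∩circle-equation L.Oα L.Oβ L.Oγ L.nontrivial C.Oa C.Ob C.Oc
        (L.equation x y Sxy) (C.equation x y S′xy)
      where
      module L = Linear L
      module C = Circular C

    -- Subtracting the equations leaves the radical axis, which is met with the first circle. If its
    -- coefficients vanish, the circles are concentric with a common point, hence equal.
    circular∩circular : ∀ {S S′ x y} → Circular S → Circular S′ → ¬ (∀ X → S X ⇔ S′ X) →
                        S (x , y) → S′ (x , y) → O² (x , y)
    circular∩circular {x = x} {y} C C′ distinct Sxy S′xy =
      line-equation∩circle-equation (sub C.Oa C′.Oa) (sub C.Ob C′.Ob) (sub C.Oc C′.Oc)
        not-concentric C.Oa C.Ob C.Oc
        (combine₂ 1# (C.equation x y Sxy) (- 1#) (C′.equation x y S′xy)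
          (solve 8 (λ a b c a′ b′ c′ x y →
              (a :- a′) :* x :+ (b :- b′) :* y :- (c :- c′) :=
              :1 :* (x :* x :+ y :* y :+ a :* x :+ b :* y :- c)
              :+ :- :1 :* (x :* x :+ y :* y :+ a′ :* x :+ b′ :* y :- c′))
            refl C.a C.b C.c C′.a C′.b C′.c x y))
        (C.equation x y Sxy)
      where
      module C = Circular C
      module C′ = Circular C′
      not-concentric : ¬ (C.a - C′.a ≈ 0# × C.b - C′.b ≈ 0#)
      not-concentric (a≈ , b≈) = distinct λ (u , v) → mk⇔
        (λ Suv → C′.solution u v (trans (sym (same-lhs u v)) (trans (C.equation u v Suv) c≈c′)))
        (λ S′uv → C.solution u v (trans (same-lhs u v) (trans (C′.equation u v S′uv) (sym c≈c′))))
        where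
        same-lhs : ∀ u v → u * u + v * v + C.a * u + C.b * v ≈ u * u + v * v + C′.a * u + C′.b * v
        same-lhs u v = +-cong (+-congˡ (*-congʳ (≈-from-difference a≈))) (*-congʳ (≈-from-difference b≈))
        c≈c′ : C.c ≈ C′.c
        c≈c′ = trans (sym (C.equation x y Sxy)) (trans (same-lhs x y) (C′.equation x y S′xy))

    intersection : ∀ {X} f g → Described f → Described g → Distinct f g →
                   X on f → X on g → O² X
    intersection f g F G distinct X∈f X∈g = go F G
      where
      X∈f′ = on⇒on-support f X∈f
      X∈g′ = on⇒on-support g X∈g
      go : Described f → Described g → _
      go (inj₁ L) (inj₁ L′) = linear∩linear L L′ distinct X∈f′ X∈g′
      go (inj₁ L) (inj₂ C)  = linear∩circular L C X∈f′ X∈g′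
      go (inj₂ C) (inj₁ L)  = linear∩circular L C X∈g′ X∈f′
      go (inj₂ C) (inj₂ C′) = circular∩circular C C′ distinct X∈f′ X∈g′

    -- Neither `W` nor `k` has to be obtainable, as for a ray drawn by the anglesector; the equation
    -- uses only `V` and the normal (d₂, -d₁).
    line-linear : ∀ {V W d₁ d₂} k → O² V → O² (d₁ , d₂) → W ≉ₚ V → W ≈ₚ V ⊕ k · (d₁ , d₂) →
                  Linear (_on line V W)
    line-linear {V@(v₁ , v₂)} {W@(w₁ , w₂)} {d₁} {d₂} k (Ov₁ , Ov₂) (Od₁ , Od₂) W≉V (w₁≈ , w₂≈) = record
      { α = d₂
      ; β = - d₁
      ; γ = d₂ * v₁ - d₁ * v₂
      ; Oα = Od₂
      ; Oβ = O-neg Od₁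
      ; Oγ = sub (mul Od₂ Ov₁) (mul Od₁ Ov₂)
      ; nontrivial = λ (d₂≈0 , -d₁≈0) → d≉0 (trans (solve 1 (λ d → d := :- :- d) refl d₁)
          (trans (-‿cong -d₁≈0) (solve 0 (:- :0 := :0) refl)) , d₂≈0)
      ; equation = λ x y (t , x≈ , y≈) → combine₃ d₂ x≈ (- d₁) y≈ t collinear
          (solve 9 (λ v₁ v₂ w₁ w₂ d₁ d₂ t x y →
              d₂ :* x :+ :- d₁ :* y :- (d₂ :* v₁ :- d₁ :* v₂) :=
              d₂ :* (x :- (v₁ :+ t :* (w₁ :- v₁))) :+ :- d₁ :* (y :- (v₂ :+ t :* (w₂ :- v₂)))
              :+ t :* (d₂ :* (w₁ :- v₁) :- d₁ :* (w₂ :- v₂)))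
            refl v₁ v₂ w₁ w₂ d₁ d₂ t x y)
      ; solution = λ x y eq →
          -- The parameter is found by projecting onto d: `P` is (X - V)·d, and `K` equals (W -
          -- V)·d.
          let P = (x - v₁) * d₁ + (y - v₂) * d₂
              t = P / K
          in t ,
            *-cancelˡ K≉0 (combine₃ (- (w₁ - v₁)) (/-cancel {P} K≉0) (- P) w₁≈ (k * d₂) eq
              (solve 10 (λ v₁ v₂ w₁ w₂ d₁ d₂ t x y k →
                  let K = k :* (d₁ :* d₁ :+ d₂ :* d₂)
                      P = (x :- v₁) :* d₁ :+ (y :- v₂) :* d₂
                  in K :* x :- K :* (v₁ :+ t :* (w₁ :- v₁)) :=
                     :- (w₁ :- v₁) :* (K :* t :- P) :+ :- P :* (w₁ :- (v₁ :+ k :* d₁))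
                     :+ k :* d₂ :* (d₂ :* x :+ :- d₁ :* y :- (d₂ :* v₁ :- d₁ :* v₂)))
                refl v₁ v₂ w₁ w₂ d₁ d₂ t x y k)) ,
            *-cancelˡ K≉0 (combine₃ (- (w₂ - v₂)) (/-cancel {P} K≉0) (- P) w₂≈ (- (k * d₁)) eq
              (solve 10 (λ v₁ v₂ w₁ w₂ d₁ d₂ t x y k →
                  let K = k :* (d₁ :* d₁ :+ d₂ :* d₂)
                      P = (x :- v₁) :* d₁ :+ (y :- v₂) :* d₂
                  in K :* y :- K :* (v₂ :+ t :* (w₂ :- v₂)) :=
                     :- (w₂ :- v₂) :* (K :* t :- P) :+ :- P :* (w₂ :- (v₂ :+ k :* d₂))
                     :+ :- (k :* d₁) :* (d₂ :* x :+ :- d₁ :* y :- (d₂ :* v₁ :- d₁ :* v₂)))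
                refl v₁ v₂ w₁ w₂ d₁ d₂ t x y k))
      }
      where
      degenerate : k * d₁ ≈ 0# → k * d₂ ≈ 0# → W ≈ₚ V
      degenerate kd₁≈0 kd₂≈0 =
        trans w₁≈ (trans (+-congˡ kd₁≈0) (+-identityʳ v₁)) ,
        trans w₂≈ (trans (+-congˡ kd₂≈0) (+-identityʳ v₂))
      k≉0 : k ≉ 0#
      k≉0 k≈0 = W≉V (degenerate (trans (*-congʳ k≈0) (zeroˡ d₁)) (trans (*-congʳ k≈0) (zeroˡ d₂)))
      d≉0 : ¬ (d₁ ≈ 0# × d₂ ≈ 0#)
      d≉0 (d₁≈0 , d₂≈0) =
        W≉V (degenerate (trans (*-congˡ d₁≈0) (zeroʳ k)) (trans (*-congˡ d₂≈0) (zeroʳ k)))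
      K = k * (d₁ * d₁ + d₂ * d₂)
      K≉0 : K ≉ 0#
      K≉0 = *-≉0 k≉0 (>⇒≉ (squares-pos d≉0))
      collinear : d₂ * (w₁ - v₁) ≈ d₁ * (w₂ - v₂)
      collinear = combine₂ d₂ w₁≈ (- d₁) w₂≈
        (solve 7 (λ v₁ v₂ w₁ w₂ d₁ d₂ k →
            d₂ :* (w₁ :- v₁) :- d₁ :* (w₂ :- v₂) :=
            d₂ :* (w₁ :- (v₁ :+ k :* d₁)) :+ :- d₁ :* (w₂ :- (v₂ :+ k :* d₂)))
          refl v₁ v₂ w₁ w₂ d₁ d₂ k)

    circle-circular : ∀ {C A} → O² C → O² A → Circular (_on circle C A)
    circle-circular {c₁ , c₂} {a₁ , a₂} (Oc₁ , Oc₂) (Oa₁ , Oa₂) = record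
      { a = - (2# * c₁)
      ; b = - (2# * c₂)
      ; c = (a₁ - c₁) * (a₁ - c₁) + (a₂ - c₂) * (a₂ - c₂) - (c₁ * c₁ + c₂ * c₂)
      ; Oa = O-neg (mul O-2 Oc₁)
      ; Ob = O-neg (mul O-2 Oc₂)
      ; Oc = sub (add (mul (sub Oa₁ Oc₁) (sub Oa₁ Oc₁)) (mul (sub Oa₂ Oc₂) (sub Oa₂ Oc₂)))
                 (add (mul Oc₁ Oc₁) (mul Oc₂ Oc₂))
      ; equation = λ x y e → combine₁ 1# e
          (solve 5 (λ c₁ c₂ r x y →
              x :* x :+ y :* y :+ :- (:2 :* c₁) :* x :+ :- (:2 :* c₂) :* y
                :- (r :- (c₁ :* c₁ :+ c₂ :* c₂)) :=
              :1 :* ((x :- c₁) :* (x :- c₁) :+ (y :- c₂) :* (y :- c₂) :- r))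
            refl c₁ c₂ _ x y)
      ; solution = λ x y e → combine₁ 1# e
          (solve 5 (λ c₁ c₂ r x y →
              (x :- c₁) :* (x :- c₁) :+ (y :- c₂) :* (y :- c₂) :- r :=
              :1 :* (x :* x :+ y :* y :+ :- (:2 :* c₁) :* x :+ :- (:2 :* c₂) :* y
                :- (r :- (c₁ :* c₁ :+ c₂ :* c₂))))
            refl c₁ c₂ _ x y)
      }

-- Constructible numbers are obtainable

module Soundness (em : ExcludedMiddle 0ℓ) (R : CompleteOrderedField) (T : Trigonometry R) where
  open CompleteOrderedField R
  open Trigonometry T
  open IntegerSolver commutativeRing
  open OrderedField R
  open SinCos em R T
  open Constructions R T
  open Coordinates R T

  Graph : Tool → ℝ → ℝ → Set
  Graph RA  = SinπGraph
  Graph RRA = Arcsin/πGraph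

  length≉0 : ∀ {P Q ℓ} → Q ≉ₚ P → HasLength P Q ℓ → ℓ ≉ 0#
  length≉0 {p₁ , p₂} {q₁ , q₂} {ℓ} Q≉P (_ , ℓℓ≈) ℓ≈0 = >⇒≉
    (squares-pos {q₁ - p₁} {q₂ - p₂} λ (e₁ , e₂) → Q≉P (≈-from-difference e₁ , ≈-from-difference e₂))
    (trans (sym ℓℓ≈) (trans (*-congʳ ℓ≈0) (zeroˡ ℓ)))

  -- p ⊥ q and u = s p + t q makes an angle with cosine c and sine z with p;
  -- hence s|p| = |u|c and t|q| = |u|z.
  sector-direction : ∀ {p₁ p₂ q₁ q₂ u₁ u₂ s t a b w c z} →
    a ≉ 0# → b ≉ 0# → 0# ≤ t → 0# ≤ b → 0# ≤ w → 0# ≤ z →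
    u₁ ≈ s * p₁ + t * q₁ → u₂ ≈ s * p₂ + t * q₂ →
    a * a ≈ p₁ * p₁ + p₂ * p₂ → b * b ≈ q₁ * q₁ + q₂ * q₂ → w * w ≈ u₁ * u₁ + u₂ * u₂ →
    p₁ * q₁ + p₂ * q₂ ≈ 0# → p₁ * u₁ + p₂ * u₂ ≈ a * w * c → z * z + c * c ≈ 1# →
    ∃[ k ] (u₁ ≈ k * (b * c * p₁ + a * z * q₁) × u₂ ≈ k * (b * c * p₂ + a * z * q₂))
  sector-direction {p₁} {p₂} {q₁} {q₂} {u₁} {u₂} {s} {t} {a} {b} {w} {c} {z}
    a≉0 b≉0 0≤t 0≤b 0≤w 0≤z u₁≈ u₂≈ aa≈ bb≈ ww≈ p⊥q pu≈ zz+cc≈1 =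
    k , along u₁≈ , along u₂≈
    where
    pu≈s∣p∣² : p₁ * u₁ + p₂ * u₂ ≈ s * (p₁ * p₁ + p₂ * p₂)
    pu≈s∣p∣² = combine₃ p₁ u₁≈ p₂ u₂≈ t p⊥q
      (solve 8 (λ p₁ p₂ q₁ q₂ u₁ u₂ s t →
          p₁ :* u₁ :+ p₂ :* u₂ :- s :* (p₁ :* p₁ :+ p₂ :* p₂) :=
          p₁ :* (u₁ :- (s :* p₁ :+ t :* q₁)) :+ p₂ :* (u₂ :- (s :* p₂ :+ t :* q₂))
          :+ t :* (p₁ :* q₁ :+ p₂ :* q₂ :- :0))
        refl p₁ p₂ q₁ q₂ u₁ u₂ s t)
    sa≈wc : s * a ≈ w * c
    sa≈wc = *-cancelˡ a≉0 (combine₃ s aa≈ (- 1#) pu≈s∣p∣² 1# pu≈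
      (solve 6 (λ a s w c n m → a :* (s :* a) :- a :* (w :* c) :=
          s :* (a :* a :- n) :+ :- :1 :* (m :- s :* n) :+ :1 :* (m :- a :* w :* c))
        refl a s w c (p₁ * p₁ + p₂ * p₂) (p₁ * u₁ + p₂ * u₂)))
    qu≈t∣q∣² : q₁ * u₁ + q₂ * u₂ ≈ t * (q₁ * q₁ + q₂ * q₂)
    qu≈t∣q∣² = combine₃ q₁ u₁≈ q₂ u₂≈ s p⊥q
      (solve 8 (λ p₁ p₂ q₁ q₂ u₁ u₂ s t →
          q₁ :* u₁ :+ q₂ :* u₂ :- t :* (q₁ :* q₁ :+ q₂ :* q₂) :=
          q₁ :* (u₁ :- (s :* p₁ :+ t :* q₁)) :+ q₂ :* (u₂ :- (s :* p₂ :+ t :* q₂))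
          :+ s :* (p₁ :* q₁ :+ p₂ :* q₂ :- :0))
        refl p₁ p₂ q₁ q₂ u₁ u₂ s t)
    ∣u∣²≈ : u₁ * u₁ + u₂ * u₂ ≈ s * (p₁ * u₁ + p₂ * u₂) + t * (q₁ * u₁ + q₂ * u₂)
    ∣u∣²≈ = combine₂ u₁ u₁≈ u₂ u₂≈
      (solve 8 (λ p₁ p₂ q₁ q₂ u₁ u₂ s t →
          u₁ :* u₁ :+ u₂ :* u₂ :- (s :* (p₁ :* u₁ :+ p₂ :* u₂) :+ t :* (q₁ :* u₁ :+ q₂ :* u₂)) :=
          u₁ :* (u₁ :- (s :* p₁ :+ t :* q₁)) :+ u₂ :* (u₂ :- (s :* p₂ :+ t :* q₂)))
        refl p₁ p₂ q₁ q₂ u₁ u₂ s t)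
    ww≈ss∣p∣²+tt∣q∣² : w * w ≈ s * (s * (a * a)) + t * (t * (b * b))
    ww≈ss∣p∣²+tt∣q∣² = trans ww≈ (trans ∣u∣²≈ (+-cong
      (*-congˡ (trans pu≈s∣p∣² (*-congˡ (sym aa≈)))) (*-congˡ (trans qu≈t∣q∣² (*-congˡ (sym bb≈))))))
    -- Pythagoras in the orthogonal frame determines only the square of t b; `0# ≤ t` singles out
    -- the ray inside the sector from its mirror image in p.
    tb≈wz : t * b ≈ w * z
    tb≈wz = square-injective (*-nonneg 0≤t 0≤b) (*-nonneg 0≤w 0≤z)
      (combine₃ (- 1#) ww≈ss∣p∣²+tt∣q∣² (- (w * w)) zz+cc≈1 (- (s * a + w * c)) sa≈wc
        (solve 7 (λ t b w z s a c → t :* b :* (t :* b) :- w :* z :* (w :* z) :=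
            :- :1 :* (w :* w :- (s :* (s :* (a :* a)) :+ t :* (t :* (b :* b))))
            :+ :- (w :* w) :* (z :* z :+ c :* c :- :1) :+ :- (s :* a :+ w :* c) :* (s :* a :- w :* c))
          refl t b w z s a c))
    ab≉0 = *-≉0 a≉0 b≉0
    -- The unit vector along u is c p / a + z q / b. Clearing denominators multiplies it by ab,
    -- which `k` compensates.
    k = w / (a * b)
    along : ∀ {p q u} → u ≈ s * p + t * q → u ≈ k * (b * c * p + a * z * q)
    along {p} {q} {u} u≈ = *-cancelˡ ab≉0 (trans (*-congˡ u≈)
      (combine₃ (b * p) sa≈wc (a * q) tb≈wz (- (b * c * p + a * z * q)) (/-cancel {w} ab≉0)
        (solve 10 (λ a b c z p q s t w k →
            a :* b :* (s :* p :+ t :* q) :- a :* b :* (k :* (b :* c :* p :+ a :* z :* q)) :=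
            b :* p :* (s :* a :- w :* c) :+ a :* q :* (t :* b :- w :* z)
            :+ :- (b :* c :* p :+ a :* z :* q) :* (a :* b :* k :- w))
          refl a b c z p q s t w k)))

  anglesect-linear : ∀ {A V B W θ} → let open ObtainableLoci SinπGraph in
    O² A → O² V → O² B → IsRightAngle A V B → O (sin θ) → O (cos θ) →
    InsideAngle A V B W → HasAngle A V W θ → Linear (_on line V W)
  anglesect-linear {a₁ , a₂} {v₁ , v₂} {b₁ , b₂} {w₁ , w₂} {θ} (Oa₁ , Oa₂) (Ov₁ , Ov₂) (Ob₁ , Ob₂)
    (_ , B≉V , _ , _ , _ , b , _ , VB@(0≤b , bb≈) , ⊥≈) Osin Ocos
    (s , t , 0≤s , 0≤t , w₁≈ , w₂≈)
    (A≉V , W≉V , 0≤θ , θ≤π , a , w , VA@(0≤a , aa≈) , (0≤w , ww≈) , dot≈) =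
    line-linear (proj₁ direction) (Ov₁ , Ov₂)
      (add (mul (mul Ob Ocos) (sub Oa₁ Ov₁)) (mul (mul Oa Osin) (sub Ob₁ Ov₁)) ,
       add (mul (mul Ob Ocos) (sub Oa₂ Ov₂)) (mul (mul Oa Osin) (sub Ob₂ Ov₂)))
      W≉V
      (from-V (proj₁ (proj₂ direction)) , from-V (proj₂ (proj₂ direction)))
    where
    open ObtainableLoci SinπGraph
    Oa : O a
    Oa = O-length (Ov₁ , Ov₂) (Oa₁ , Oa₂) VA
    Ob : O b
    Ob = O-length (Ov₁ , Ov₂) (Ob₁ , Ob₂) VB
    from-V : ∀ {u v x} → u - v ≈ x → u ≈ v + x
    from-V {u} {v} e = trans (solve 2 (λ u v → u := v :+ (u :- v)) refl u v) (+-congˡ e)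
    to-V : ∀ {u v x y} → u ≈ v + x + y → u - v ≈ x + y
    to-V {u} {v} {x} {y} e = trans (+-congʳ e)
      (solve 3 (λ v x y → v :+ x :+ y :- v := x :+ y) refl v x y)
    direction = sector-direction {s = s} (length≉0 A≉V VA) (length≉0 B≉V VB)
      0≤t 0≤b 0≤w (sin-nonneg 0≤θ θ≤π)
      (to-V w₁≈) (to-V w₂≈) aa≈ bb≈ ww≈ (trans ⊥≈ (trans (*-congˡ cos-π/2) (zeroʳ _))) dot≈
      (sin²+cos²≈1 θ)

  -- The inner product of the sides gives cos θ, Pythagoras gives sin θ, and acuteness makes θ the
  -- principal arcsine of its sine.
  divide-obtainable : ∀ {A V W θ} → let open ObtainableLoci Arcsin/πGraph in
    O² A → O² V → O² W → HasAngle A V W θ → 0# < θ → θ < π / 2# → O (2# * θ / π)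
  divide-obtainable {a₁ , a₂} {v₁ , v₂} {w₁ , w₂} {θ} (Oa₁ , Oa₂) (Ov₁ , Ov₂) (Ow₁ , Ow₂)
    (A≉V , W≉V , _ , _ , a , w , VA , VW , dot≈) 0<θ θ<π/2 =
    resp (solve 2 (λ θ i → :2 :* (:1 :* i :* θ) := :2 :* θ :* i) refl θ (π ⁻¹))
      (mul O-2 (extra Osin (∣sin∣≤1 θ , θ , (-π/2≤θ , <⇒≤ θ<π/2 , refl) , refl)))
    where
    open ObtainableLoci Arcsin/πGraph
    Oaw : O (a * w)
    Oaw = mul (O-length (Ov₁ , Ov₂) (Oa₁ , Oa₂) VA) (O-length (Ov₁ , Ov₂) (Ow₁ , Ow₂) VW)
    Ocos : O (cos θ)
    Ocos = O-quotient Oaw (*-≉0 (length≉0 A≉V VA) (length≉0 W≉V VW))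
      (add (mul (sub Oa₁ Ov₁) (sub Ow₁ Ov₁)) (mul (sub Oa₂ Ov₂) (sub Ow₂ Ov₂))) (sym dot≈)
    Osin : O (sin θ)
    Osin = O-root (resp
      (sym (combine₁ 1# (sin²+cos²≈1 θ)
        (solve 2 (λ s c → s :* s :- (:1 :- c :* c) := :1 :* (s :* s :+ c :* c :- :1))
          refl (sin θ) (cos θ))))
      (sub one (mul Ocos Ocos)))
    -π/2≤θ : - (π / 2#) ≤ θ
    -π/2≤θ = <⇒≤ (<-from-difference (+-pos 0<θ 0<π/2)
      (solve 2 (λ θ h → θ :- :- h := θ :+ h) refl θ (π / 2#)))

  constructed⇒obtainable : ∀ {τ P} → Constructed τ P → ObtainableLoci.O² (Graph τ) P
  drawn⇒described : ∀ {τ f} → Drawn τ f → ObtainableLoci.Described (Graph τ) f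

  constructed⇒obtainable {τ} origin = O-0 , O-0
    where open ObtainableLoci (Graph τ)
  constructed⇒obtainable {τ} unit = one , O-0
    where open ObtainableLoci (Graph τ)
  constructed⇒obtainable {τ} (intersect {f = f} {g} F G distinct X∈f X∈g) =
    intersection f g (drawn⇒described F) (drawn⇒described G) distinct X∈f X∈g
    where open ObtainableLoci (Graph τ)
  constructed⇒obtainable (divide {P = p₁ , p₂} {q₁ , q₂} A V _ _ W _ angle 0<θ θ<π/2 P Q) =
    let Oλ = divide-obtainable (constructed⇒obtainable A) (constructed⇒obtainable V)
               (constructed⇒obtainable W) angle 0<θ θ<π/2
        Op₁ , Op₂ = constructed⇒obtainable P
        Oq₁ , Oq₂ = constructed⇒obtainable Q
    in add Op₁ (mul Oλ (sub Oq₁ Op₁)) , add Op₂ (mul Oλ (sub Oq₂ Op₂))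
  constructed⇒obtainable (resp (x≈ , y≈) P) =
    let Ox , Oy = constructed⇒obtainable P
    in resp x≈ Ox , resp y≈ Oy

  drawn⇒described {τ} (straightedge {A = a₁ , a₂} {b₁ , b₂} A B A≉B) =
    let Oa₁ , Oa₂ = constructed⇒obtainable A
        Ob₁ , Ob₂ = constructed⇒obtainable B
    in inj₁ (line-linear 1# (Oa₁ , Oa₂) (sub Ob₁ Oa₁ , sub Ob₂ Oa₂)
         (λ (e₁ , e₂) → A≉B (sym e₁ , sym e₂)) (along a₁ b₁ , along a₂ b₂))
    where
    open ObtainableLoci (Graph τ)
    along : ∀ a b → b ≈ a + 1# * (b - a)
    along = solve 2 (λ a b → b := a :+ :1 :* (b :- a)) refl
  drawn⇒described {τ} (compass C A _) =
    inj₂ (circle-circular (constructed⇒obtainable C) (constructed⇒obtainable A))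
    where open ObtainableLoci (Graph τ)
  drawn⇒described (anglesect {p = p} {q} A V B right P Q ∣PQ∣ P′ Q′ ∣P′Q′∣ 0<q _ inside angle) =
    inj₁ (anglesect-linear (constructed⇒obtainable A) (constructed⇒obtainable V)
      (constructed⇒obtainable B) right Osin Ocos inside angle)
    where
    open ObtainableLoci SinπGraph
    Oratio : O (p / q * ½)
    Oratio = mul (div (O-length (constructed⇒obtainable P) (constructed⇒obtainable Q) ∣PQ∣)
                      (O-length (constructed⇒obtainable P′) (constructed⇒obtainable Q′) ∣P′Q′∣)
                      (>⇒≉ 0<q))
                 (resp (*-identityˡ ½) (div one O-2 2≉0))
    Osin : O (sin (p / q * (π / 2#)))
    Osin = extra Oratio (sin-cong
      (solve 3 (λ r π h → r :* (π :* h) := π :* (r :* h)) refl (p / q) π ½))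
    Ocos : O (cos (p / q * (π / 2#)))
    -- The cosine is a sine a quarter turn later, that is, at an argument larger by ½.
    Ocos = extra (add Oratio (resp (*-identityˡ ½) (div one O-2 2≉0)))
      (trans (sym (sin-+π/2 _)) (sin-cong
        (solve 3 (λ r π h → r :* (π :* h) :+ π :* h := π :* (r :* h :+ h)) refl (p / q) π ½)))

  constructible⇒obtainable : ∀ {τ r} → Constructible τ r → Obtainable (Graph τ) r
  constructible⇒obtainable {τ} {r} (_ , _ , P , Q , ∣PQ∣) =
    -- Passing through r² removes the sign that the length ∣r∣ has lost.
    O-root (resp (∣∣-square r) (mul O∣r∣ O∣r∣))
    where
    open ObtainableLoci (Graph τ)
    O∣r∣ = O-length (constructed⇒obtainable P) (constructed⇒obtainable Q) ∣PQ∣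

-- Intersections, reflections and quarter turns by straightedge and compass

module RulerAndCompass (R : CompleteOrderedField) (T : Trigonometry R) (τ : Tool) where
  open CompleteOrderedField R
  open IntegerSolver commutativeRing
  open OrderedField R
  open Constructions R T

  C : Point → Set
  C = Constructed τ

  cross : Vector → Vector → ℝ
  cross (a , b) (c , d) = a * d - b * c

  0<distance² : ∀ {a₁ a₂ b₁ b₂} → (a₁ , a₂) ≉ₚ (b₁ , b₂) →
                0# < (b₁ - a₁) * (b₁ - a₁) + (b₂ - a₂) * (b₂ - a₂)
  0<distance² A≉B = squares-pos λ (e₁ , e₂) →
    A≉B (sym (≈-from-difference e₁) , sym (≈-from-difference e₂))

  -- The squared distance to a point grows quadratically along a line: its
  -- second difference at A is 2|AB|².
  line-circle-distinct : ∀ {A B O P} → A ≉ₚ B → Distinct (line A B) (circle O P)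
  line-circle-distinct {A@(a₁ , a₂)} {B@(b₁ , b₂)} {O@(o₁ , o₂)} {P} A≉B same =
    >⇒≉ (*-pos 0<2 (0<distance² A≉B))
      (combine₃ 1# (at 1#) 1# (at (- 1#)) (- 2#) (at 0#)
        (solve 7 (λ a₁ a₂ b₁ b₂ o₁ o₂ r →
            let q = λ t → (a₁ :+ t :* (b₁ :- a₁) :- o₁) :* (a₁ :+ t :* (b₁ :- a₁) :- o₁)
                       :+ (a₂ :+ t :* (b₂ :- a₂) :- o₂) :* (a₂ :+ t :* (b₂ :- a₂) :- o₂)
            in :2 :* ((b₁ :- a₁) :* (b₁ :- a₁) :+ (b₂ :- a₂) :* (b₂ :- a₂)) :- :0 :=
               :1 :* (q :1 :- r) :+ :1 :* (q (:- :1) :- r) :+ :- :2 :* (q :0 :- r))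
          refl a₁ a₂ b₁ b₂ o₁ o₂ ⟨ O ⟶ P , O ⟶ P ⟩))
    where
    at : ∀ t → let X = A ⊕ t · (A ⟶ B) in ⟨ O ⟶ X , O ⟶ X ⟩ ≈ ⟨ O ⟶ P , O ⟶ P ⟩
    at t = Equivalence.to (same (A ⊕ t · (A ⟶ B))) (t , refl , refl)

  -- Were the lines equal, A and B would have parameters t₀ and t₁ on PQ, and B - A would be (t₁ -
  -- t₀)(Q - P).
  line-line-distinct : ∀ {A B P Q} → cross (A ⟶ B) (P ⟶ Q) ≉ 0# → Distinct (line A B) (line P Q)
  line-line-distinct {A@(a₁ , a₂)} {B@(b₁ , b₂)} {p₁ , p₂} {q₁ , q₂} cross≉0 same
    with Equivalence.to (same (A ⊕ 0# · (A ⟶ B))) (0# , refl , refl)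
       | Equivalence.to (same (A ⊕ 1# · (A ⟶ B))) (1# , refl , refl)
  ... | t₀ , x₀≈ , y₀≈ | t₁ , x₁≈ , y₁≈ = cross≉0
    (combine₂ (q₂ - p₂) (proportional x₀≈ x₁≈) (- (q₁ - p₁)) (proportional y₀≈ y₁≈)
      (solve 5 (λ d₁ d₂ e₁ e₂ t → d₁ :* e₂ :- d₂ :* e₁ :- :0 :=
          e₂ :* (d₁ :- t :* e₁) :+ :- e₁ :* (d₂ :- t :* e₂))
        refl (b₁ - a₁) (b₂ - a₂) (q₁ - p₁) (q₂ - p₂) (t₁ - t₀)))
    where
    proportional : ∀ {a b p q} → a + 0# * (b - a) ≈ p + t₀ * (q - p) →
                   a + 1# * (b - a) ≈ p + t₁ * (q - p) → b - a ≈ (t₁ - t₀) * (q - p)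
    proportional {a} {b} {p} {q} e₀ e₁ = combine₂ 1# e₁ (- 1#) e₀
      (solve 6 (λ a b p q t₀ t₁ → b :- a :- (t₁ :- t₀) :* (q :- p) :=
          :1 :* (a :+ :1 :* (b :- a) :- (p :+ t₁ :* (q :- p)))
          :+ :- :1 :* (a :+ :0 :* (b :- a) :- (p :+ t₀ :* (q :- p))))
        refl a b p q t₀ t₁)

  -- The nonzero cross product supplies every side condition: two different points on each line, and
  -- two different lines.
  line∩line : ∀ {A B P Q X} → C A → C B → C P → C Q → cross (A ⟶ B) (P ⟶ Q) ≉ 0# →
              X on line A B → X on line P Q → C X
  line∩line {a₁ , a₂} {b₁ , b₂} {p₁ , p₂} {q₁ , q₂} CA CB CP CQ cross≉0 =
    intersect
      (straightedge CA CB λ (e₁ , e₂) → cross≉0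
        (combine₂ (- (q₂ - p₂)) e₁ (q₁ - p₁) e₂
          (solve 6 (λ a₁ a₂ b₁ b₂ u v → (b₁ :- a₁) :* v :- (b₂ :- a₂) :* u :- :0 :=
              :- v :* (a₁ :- b₁) :+ u :* (a₂ :- b₂)) refl a₁ a₂ b₁ b₂ (q₁ - p₁) (q₂ - p₂))))
      (straightedge CP CQ λ (e₁ , e₂) → cross≉0
        (combine₂ (b₂ - a₂) e₁ (- (b₁ - a₁)) e₂
          (solve 6 (λ p₁ p₂ q₁ q₂ u v → u :* (q₂ :- p₂) :- v :* (q₁ :- p₁) :- :0 :=
              v :* (p₁ :- q₁) :+ :- u :* (p₂ :- q₂)) refl p₁ p₂ q₁ q₂ (b₁ - a₁) (b₂ - a₂))))
      (line-line-distinct cross≉0)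

  line∩circle : ∀ {A B O P X} → C A → C B → A ≉ₚ B → C O → C P → O ≉ₚ P →
                X on line A B → X on circle O P → C X
  line∩circle CA CB A≉B CO CP O≉P =
    intersect (straightedge CA CB A≉B) (compass CO CP O≉P) (line-circle-distinct A≉B)

  reflect : ∀ {A B} → C A → C B → A ≉ₚ B → C (B ⊕ (A ⟶ B))
  reflect {a₁ , a₂} {b₁ , b₂} CA CB A≉B =
    line∩circle CA CB A≉B CB CA (λ (e₁ , e₂) → A≉B (sym e₁ , sym e₂))
      (2# , beyond a₁ b₁ , beyond a₂ b₂)
      (solve 4 (λ a₁ a₂ b₁ b₂ →
          (b₁ :+ (b₁ :- a₁) :- b₁) :* (b₁ :+ (b₁ :- a₁) :- b₁)
            :+ (b₂ :+ (b₂ :- a₂) :- b₂) :* (b₂ :+ (b₂ :- a₂) :- b₂) :=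
          (a₁ :- b₁) :* (a₁ :- b₁) :+ (a₂ :- b₂) :* (a₂ :- b₂))
        refl a₁ a₂ b₁ b₂)
    where
    beyond : ∀ a b → b + (b - a) ≈ a + 2# * (b - a)
    beyond = solve 2 (λ a b → b :+ (b :- a) := a :+ :2 :* (b :- a)) refl

  -- With d = B − A, the circles of radius 5|d| about A ± 3d meet on the
  -- perpendicular at A at height 4|d|.
  rotate : ∀ {a₁ a₂ b₁ b₂} → C (a₁ , a₂) → C (b₁ , b₂) → (a₁ , a₂) ≉ₚ (b₁ , b₂) →
           C (a₁ - (b₂ - a₂) , a₂ + (b₁ - a₁))
  rotate {a₁} {a₂} {b₁} {b₂} CA CB A≉B =
    line∩circle CA CX A≉X CA CB A≉B
      -- The apex `X` has height 4∣d∣, so the rotated point is a quarter of the way to it.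
      (½ * ½ ,
       combine₁ (- (b₂ - a₂) * - (2# * ½ + 1#)) 2*½
         (solve 3 (λ a d h → a :- d :- (a :+ h :* h :* ((a :- :2 :* :2 :* d) :- a)) :=
             :- d :* :- (:2 :* h :+ :1) :* (:2 :* h :- :1)) refl a₁ (b₂ - a₂) ½) ,
       combine₁ (- (b₁ - a₁) * (2# * ½ + 1#)) 2*½
         (solve 3 (λ a d h → a :+ d :- (a :+ h :* h :* ((a :+ :2 :* :2 :* d) :- a)) :=
             :- d :* (:2 :* h :+ :1) :* (:2 :* h :- :1)) refl a₂ (b₁ - a₁) ½))
      (solve 4 (λ a₁ a₂ d₁ d₂ →
          (a₁ :- d₂ :- a₁) :* (a₁ :- d₂ :- a₁) :+ (a₂ :+ d₁ :- a₂) :* (a₂ :+ d₁ :- a₂) :=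
          d₁ :* d₁ :+ d₂ :* d₂) refl a₁ a₂ (b₁ - a₁) (b₂ - a₂))
    where
    d₁ = b₁ - a₁
    d₂ = b₂ - a₂
    0<∣d∣² : 0# < d₁ * d₁ + d₂ * d₂
    0<∣d∣² = 0<distance² A≉B
    at : ℝ → Point
    at k = (a₁ + k * d₁ , a₂ + k * d₂)
    apart : ∀ {j k} → (k - j) * (k - j) ≉ 0# → at j ≉ₚ at k
    apart {j} {k} k-j≉0 (e₁ , e₂) = *-≉0 k-j≉0 (>⇒≉ 0<∣d∣²)
      (combine₂ (- (k - j) * d₁) e₁ (- (k - j) * d₂) e₂
        (solve 6 (λ a₁ a₂ d₁ d₂ j k →
            (k :- j) :* (k :- j) :* (d₁ :* d₁ :+ d₂ :* d₂) :- :0 :=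
            :- (k :- j) :* d₁ :* (a₁ :+ j :* d₁ :- (a₁ :+ k :* d₁))
            :+ :- (k :- j) :* d₂ :* (a₂ :+ j :* d₂ :- (a₂ :+ k :* d₂)))
          refl a₁ a₂ d₁ d₂ j k))
    next : ∀ j k → (k - j) * (k - j) ≈ 1# → C (at j) → C (at k) → C (at (k + (k - j)))
    next j k ±1 Cj Ck = resp (double a₁ d₁ , double a₂ d₂) (reflect Cj Ck (apart λ e → >⇒≉ 0<1 (trans (sym ±1) e)))
      where
      double : ∀ a d → (a + k * d) + ((a + k * d) - (a + j * d)) ≈ a + (k + (k - j)) * d
      double a d = solve 4 (λ a d j k →
        (a :+ k :* d) :+ ((a :+ k :* d) :- (a :+ j :* d)) := a :+ (k :+ (k :- j)) :* d) refl a d j k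
    -- The values 2, 3, -1, -2, -3, written as the successive reflections by `next` produce them.
    k₂ k₃ k₋₁ k₋₂ k₋₃ : ℝ
    k₂  = 1# + (1# - 0#)
    k₃  = k₂ + (k₂ - 1#)
    k₋₁ = 0# + (0# - 1#)
    k₋₂ = k₋₁ + (k₋₁ - 0#)
    k₋₃ = k₋₂ + (k₋₂ - k₋₁)
    :k₂ :k₃ :k₋₁ :k₋₂ :k₋₃ : ∀ {n} → Polynomial n
    :k₂  = :1 :+ (:1 :- :0)
    :k₃  = :k₂ :+ (:k₂ :- :1)
    :k₋₁ = :0 :+ (:0 :- :1)
    :k₋₂ = :k₋₁ :+ (:k₋₁ :- :0)
    :k₋₃ = :k₋₂ :+ (:k₋₂ :- :k₋₁)
    C0 : C (at 0#)
    C0 = resp (at-0 a₁ d₁ , at-0 a₂ d₂) CA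
      where
      at-0 : ∀ a d → a ≈ a + 0# * d
      at-0 = solve 2 (λ a d → a := a :+ :0 :* d) refl
    C1 : C (at 1#)
    C1 = resp (at-1 a₁ b₁ , at-1 a₂ b₂) CB
      where
      at-1 : ∀ a b → b ≈ a + 1# * (b - a)
      at-1 = solve 2 (λ a b → b := a :+ :1 :* (b :- a)) refl
    C2 : C (at k₂)
    C2 = next 0# 1# (solve 0 ((:1 :- :0) :* (:1 :- :0) := :1) refl) C0 C1
    C3 : C (at k₃)
    C3 = next 1# k₂ (solve 0 ((:k₂ :- :1) :* (:k₂ :- :1) := :1) refl) C1 C2
    C₋1 : C (at k₋₁)
    C₋1 = next 1# 0# (solve 0 ((:0 :- :1) :* (:0 :- :1) := :1) refl) C1 C0
    C₋2 : C (at k₋₂)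
    C₋2 = next 0# k₋₁ (solve 0 ((:k₋₁ :- :0) :* (:k₋₁ :- :0) := :1) refl) C0 C₋1
    C₋3 : C (at k₋₃)
    C₋3 = next k₋₁ k₋₂ (solve 0 ((:k₋₂ :- :k₋₁) :* (:k₋₂ :- :k₋₁) := :1) refl) C₋1 C₋2
    24≉0 : 2# * 2# * 2# * (2# + 1#) ≉ 0#
    24≉0 = *-≉0 (*-≉0 (*-≉0 2≉0 2≉0) 2≉0) (>⇒≉ (+-pos 0<2 0<1))
    25≉0 : ∀ {x} → x ≈ 2# * 2# * 2# * (2# + 1#) + 1# → x ≉ 0#
    25≉0 x≈25 x≈0 = >⇒≉ (+-pos (*-pos (*-pos (*-pos 0<2 0<2) 0<2) (+-pos 0<2 0<1)) 0<1)
      (trans (sym x≈25) x≈0)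
    X : Point
    X = (a₁ - 2# * 2# * d₂ , a₂ + 2# * 2# * d₁)
    CX : C X
    CX = intersect
      (compass C₋3 C2 (apart (25≉0 (solve 0
        ((:k₂ :- :k₋₃) :* (:k₂ :- :k₋₃) := :2 :* :2 :* :2 :* (:2 :+ :1) :+ :1) refl))))
      (compass C3 C₋2 (apart (25≉0 (solve 0
        ((:k₋₂ :- :k₃) :* (:k₋₂ :- :k₃) := :2 :* :2 :* :2 :* (:2 :+ :1) :+ :1) refl))))
      -- The point at 2d lies on the first circle, but its squared distance from the second centre
      -- is ∣d∣² instead of 25∣d∣², hence the 24.
      (λ same → *-≉0 24≉0 (>⇒≉ 0<∣d∣²) (combine₁ (- 1#) (Equivalence.to (same (at k₂)) refl)
        (solve 4 (λ a₁ a₂ d₁ d₂ →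
            let sq = λ j k → (a₁ :+ k :* d₁ :- (a₁ :+ j :* d₁)) :* (a₁ :+ k :* d₁ :- (a₁ :+ j :* d₁))
                          :+ (a₂ :+ k :* d₂ :- (a₂ :+ j :* d₂)) :* (a₂ :+ k :* d₂ :- (a₂ :+ j :* d₂))
            in :2 :* :2 :* :2 :* (:2 :+ :1) :* (d₁ :* d₁ :+ d₂ :* d₂) :- :0 :=
               :- :1 :* (sq :k₃ :k₂ :- sq :k₃ :k₋₂))
          refl a₁ a₂ d₁ d₂)))
      (pythagorean k₋₃ k₂ (solve 0 (:k₋₃ :* :k₋₃ := :2 :* :2 :* :2 :+ :1) refl)
        (solve 0 ((:k₂ :- :k₋₃) :* (:k₂ :- :k₋₃) := :2 :* :2 :* :2 :* (:2 :+ :1) :+ :1) refl))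
      (pythagorean k₃ k₋₂ (solve 0 (:k₃ :* :k₃ := :2 :* :2 :* :2 :+ :1) refl)
        (solve 0 ((:k₋₂ :- :k₃) :* (:k₋₂ :- :k₃) := :2 :* :2 :* :2 :* (:2 :+ :1) :+ :1) refl))
      where
      -- `X` is at squared distance (j² + 16)∣d∣² from the centre, and 9 + 16 = 25.
      pythagorean : ∀ j k → j * j ≈ 2# * 2# * 2# + 1# →
                    (k - j) * (k - j) ≈ 2# * 2# * 2# * (2# + 1#) + 1# →
                    X on circle (at j) (at k)
      pythagorean j k 9≈ 25≈ = combine₂ (d₁ * d₁ + d₂ * d₂) 9≈ (- (d₁ * d₁ + d₂ * d₂)) 25≈
        (solve 6 (λ a₁ a₂ d₁ d₂ j k →
            (a₁ :- :2 :* :2 :* d₂ :- (a₁ :+ j :* d₁)) :* (a₁ :- :2 :* :2 :* d₂ :- (a₁ :+ j :* d₁))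
            :+ (a₂ :+ :2 :* :2 :* d₁ :- (a₂ :+ j :* d₂)) :* (a₂ :+ :2 :* :2 :* d₁ :- (a₂ :+ j :* d₂))
            :- ((a₁ :+ k :* d₁ :- (a₁ :+ j :* d₁)) :* (a₁ :+ k :* d₁ :- (a₁ :+ j :* d₁))
            :+ (a₂ :+ k :* d₂ :- (a₂ :+ j :* d₂)) :* (a₂ :+ k :* d₂ :- (a₂ :+ j :* d₂))) :=
            (d₁ :* d₁ :+ d₂ :* d₂) :* (j :* j :- (:2 :* :2 :* :2 :+ :1))
            :+ :- (d₁ :* d₁ :+ d₂ :* d₂) :* ((k :- j) :* (k :- j) :- (:2 :* :2 :* :2 :* (:2 :+ :1) :+ :1)))
          refl a₁ a₂ d₁ d₂ j k)
    A≉X : (a₁ , a₂) ≉ₚ X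
    A≉X (e₁ , e₂) = *-≉0 (*-≉0 2≉0 2≉0) (>⇒≉ 0<∣d∣²) (combine₂ d₂ e₁ (- d₁) e₂
      (solve 4 (λ a₁ a₂ d₁ d₂ → :2 :* :2 :* (d₁ :* d₁ :+ d₂ :* d₂) :- :0 :=
          d₂ :* (a₁ :- (a₁ :- :2 :* :2 :* d₂)) :+ :- d₁ :* (a₂ :- (a₂ :+ :2 :* :2 :* d₁)))
        refl a₁ a₂ d₁ d₂))

-- Arithmetic on constructed coordinates

module ConstructedNumbers (em : ExcludedMiddle 0ℓ) (R : CompleteOrderedField) (T : Trigonometry R)
                          (τ : Tool) where
  open CompleteOrderedField R
  open IntegerSolver commutativeRing
  open OrderedField R
  open Constructions R T
  open RulerAndCompass R T τ

  -- With d = B - A and J the quarter turn, the auxiliary points A + Jd and B - Jd are symmetric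
  -- about the midpoint and lie on opposite sides of AB.
  midpoint : ∀ {a₁ a₂ b₁ b₂} → C (a₁ , a₂) → C (b₁ , b₂) → (a₁ , a₂) ≉ₚ (b₁ , b₂) →
             C (½ * (a₁ + b₁) , ½ * (a₂ + b₂))
  midpoint {a₁} {a₂} {b₁} {b₂} CA CB A≉B =
    line∩line CA CB
      (rotate CA CB A≉B) (rotate CB CA (λ (e₁ , e₂) → A≉B (sym e₁ , sym e₂)))
      (λ cross≈0 → *-≉0 2≉0 (>⇒≉ (0<distance² A≉B)) (combine₁ (- 1#) cross≈0
        (solve 4 (λ a₁ a₂ b₁ b₂ →
            :2 :* ((b₁ :- a₁) :* (b₁ :- a₁) :+ (b₂ :- a₂) :* (b₂ :- a₂)) :- :0 :=
            :- :1 :* ((b₁ :- a₁) :* ((b₂ :+ (a₁ :- b₁)) :- (a₂ :+ (b₁ :- a₁)))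
              :- (b₂ :- a₂) :* ((b₁ :- (a₂ :- b₂)) :- (a₁ :- (b₂ :- a₂))) :- :0))
          refl a₁ a₂ b₁ b₂)))
      (½ , halfway a₁ b₁ , halfway a₂ b₂)
      (½ ,
       combine₁ (a₁ - (b₂ - a₂)) 2*½
         (solve 5 (λ a b u v h →
             h :* (a :+ b) :- (a :- (v :- u) :+ h :* ((b :- (u :- v)) :- (a :- (v :- u)))) :=
             (a :- (v :- u)) :* (:2 :* h :- :1)) refl a₁ b₁ a₂ b₂ ½) ,
       combine₁ (a₂ + (b₁ - a₁)) 2*½
         (solve 5 (λ a b u v h →
             h :* (a :+ b) :- (a :+ (v :- u) :+ h :* ((b :+ (u :- v)) :- (a :+ (v :- u)))) :=
             (a :+ (v :- u)) :* (:2 :* h :- :1)) refl a₂ b₂ a₁ b₁ ½))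
    where
    halfway : ∀ a b → ½ * (a + b) ≈ a + ½ * (b - a)
    halfway a b = combine₁ a 2*½
      (solve 3 (λ a b h → h :* (a :+ b) :- (a :+ h :* (b :- a)) := a :* (:2 :* h :- :1)) refl a b ½)

  -- The fourth vertex is A reflected in the centre of BD. The cases are the coincidences that leave
  -- no line to draw; admitting them makes vector addition total.
  parallelogram : ∀ {a₁ a₂ b₁ b₂ d₁ d₂} → C (a₁ , a₂) → C (b₁ , b₂) → C (d₁ , d₂) →
                  C (b₁ + d₁ - a₁ , b₂ + d₂ - a₂)
  parallelogram {a₁} {a₂} {b₁} {b₂} {d₁} {d₂} CA CB CD with em {(b₁ , b₂) ≈ₚ (d₁ , d₂)}
  ... | yes (b≈d₁ , b≈d₂) with em {(a₁ , a₂) ≈ₚ (b₁ , b₂)}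
  ...   | yes (a≈b₁ , a≈b₂) = resp (collapse a≈b₁ , collapse a≈b₂) CD
    where
    collapse : ∀ {a b d} → a ≈ b → d ≈ b + d - a
    collapse {a} {b} {d} a≈b = combine₁ 1# a≈b
      (solve 3 (λ a b d → d :- (b :+ d :- a) := :1 :* (a :- b)) refl a b d)
  ...   | no A≉B = resp (double b≈d₁ , double b≈d₂) (reflect CA CB A≉B)
    where
    double : ∀ {a b d} → b ≈ d → b + (b - a) ≈ b + d - a
    double {a} {b} {d} b≈d = combine₁ 1# b≈d
      (solve 3 (λ a b d → b :+ (b :- a) :- (b :+ d :- a) := :1 :* (b :- d)) refl a b d)
  parallelogram {a₁} {a₂} {b₁} {b₂} {d₁} {d₂} CA CB CD
      | no B≉D with em {(a₁ , a₂) ≈ₚ (½ * (b₁ + d₁) , ½ * (b₂ + d₂))}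
  ...   | yes (a≈m₁ , a≈m₂) = resp (fixed a≈m₁ , fixed a≈m₂) CA
    where
    fixed : ∀ {a b d} → a ≈ ½ * (b + d) → a ≈ b + d - a
    fixed {a} {b} {d} a≈m = combine₂ 2# a≈m (b + d) 2*½
      (solve 4 (λ a b d h → a :- (b :+ d :- a) :=
          :2 :* (a :- h :* (b :+ d)) :+ (b :+ d) :* (:2 :* h :- :1)) refl a b d ½)
  ...   | no A≉M = resp (double b₁ d₁ , double b₂ d₂) (reflect CA (midpoint CB CD B≉D) A≉M)
    where
    double : ∀ {a} b d → ½ * (b + d) + (½ * (b + d) - a) ≈ b + d - a
    double {a} b d = combine₁ (b + d) 2*½
      (solve 4 (λ a b d h → h :* (b :+ d) :+ (h :* (b :+ d) :- a) :- (b :+ d :- a) :=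
          (b :+ d) :* (:2 :* h :- :1)) refl a b d ½)

  C-+ : ∀ {x y u v} → C (x , y) → C (u , v) → C (x + u , y + v)
  C-+ {x} {y} {u} {v} P Q = resp (drop x u , drop y v) (parallelogram origin P Q)
    where
    drop : ∀ x u → x + u - 0# ≈ x + u
    drop = solve 2 (λ x u → x :+ u :- :0 := x :+ u) refl

  C-sub : ∀ {x y u v} → C (x , y) → C (u , v) → C (x - u , y - v)
  C-sub {x} {y} {u} {v} P Q = resp (drop x u , drop y v) (parallelogram Q P origin)
    where
    drop : ∀ x u → x + 0# - u ≈ x - u
    drop = solve 2 (λ x u → x :+ :0 :- u := x :- u) refl

  C-rotate : ∀ {x y} → C (x , y) → C (- y , x)
  C-rotate {x} {y} P with em {(0# , 0#) ≈ₚ (x , y)}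
  ... | yes (0≈x , 0≈y) = resp (trans (sym (solve 0 (:- :0 := :0) refl)) (-‿cong 0≈y) , 0≈x) origin
  ... | no O≉P = resp (solve 1 (λ y → :0 :- (y :- :0) := :- y) refl y ,
                       solve 1 (λ x → :0 :+ (x :- :0) := x) refl x) (rotate origin P O≉P)

  K : ℝ → Set
  K x = C (x , 0#)

  K-resp : ∀ {x y} → x ≈ y → K x → K y
  K-resp x≈y = resp (x≈y , refl)

  vertical : ∀ {x} → K x → C (0# , x)
  vertical Kx = resp (solve 0 (:- :0 := :0) refl , refl) (C-rotate Kx)

  horizontal : ∀ {y} → C (0# , y) → K y
  horizontal {y} P = resp (solve 1 (λ y → :0 :- :- y := y) refl y , solve 0 (:0 :- :0 := :0) refl)
    (C-sub origin (C-rotate P))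

  point : ∀ {x y} → K x → K y → C (x , y)
  point Kx Ky = resp (+-identityʳ _ , +-identityˡ _) (C-+ Kx (vertical Ky))

  -- The vertical is drawn through P and P + (0, 1), which differ even when P already lies on the
  -- axis.
  abscissa : ∀ {x y} → C (x , y) → K x
  abscissa {x} {y} P = line∩line P (C-+ P (vertical unit)) origin unit
    (λ cross≈0 → >⇒≉ 0<1 (combine₁ (- 1#) cross≈0
      (solve 2 (λ x y → :1 :- :0 := :- :1 :*
          ((x :+ :0 :- x) :* (:0 :- :0) :- (y :+ :1 :- y) :* (:1 :- :0) :- :0)) refl x y)))
    (- y , solve 2 (λ x y → x := x :+ :- y :* (x :+ :0 :- x)) refl x y
         , solve 1 (λ y → :0 := y :+ :- y :* (y :+ :1 :- y)) refl y)
    (x , solve 1 (λ x → x := :0 :+ x :* (:1 :- :0)) refl x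
       , solve 1 (λ x → :0 := :0 :+ x :* (:0 :- :0)) refl x)

  ordinate : ∀ {x y} → C (x , y) → K y
  ordinate {x} {y} P = horizontal (resp (-‿inverseʳ x , solve 1 (λ y → y :- :0 := y) refl y)
    (C-sub P (abscissa P)))

  K-+ : ∀ {x y} → K x → K y → K (x + y)
  K-+ Kx Ky = abscissa (C-+ Kx Ky)

  K-sub : ∀ {x y} → K x → K y → K (x - y)
  K-sub Kx Ky = abscissa (C-sub Kx Ky)

  K-neg : ∀ {x} → K x → K (- x)
  K-neg Kx = K-resp (+-identityˡ _) (K-sub origin Kx)

  -- The parallel through (1, 0) to the line joining (y, 0) and (0, x) meets
  -- the vertical axis at height x / y.
  K-/ : ∀ {x y} → K x → K y → y ≉ 0# → K (x / y)
  -- The point (1 - y, x) is (1, 0) moved by the vector from (y, 0) to (0, x).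
  K-/ {x} {y} Kx Ky y≉0 = horizontal (line∩line unit (point (K-sub unit Ky) Kx) origin (vertical unit)
    (λ cross≈0 → y≉0 (combine₁ (- 1#) cross≈0
      (solve 2 (λ x y → y :- :0 := :- :1 :*
          ((:1 :- y :- :1) :* (:1 :- :0) :- (x :- :0) :* (:0 :- :0) :- :0)) refl x y)))
    (y ⁻¹ , combine₁ 1# (*-inverseʳ y y≉0)
              (solve 2 (λ y i → :0 :- (:1 :+ i :* (:1 :- y :- :1)) := :1 :* (y :* i :- :1)) refl y (y ⁻¹))
          , solve 2 (λ x i → x :* i := :0 :+ i :* (x :- :0)) refl x (y ⁻¹))
    (x / y , solve 1 (λ q → :0 := :0 :+ q :* (:0 :- :0)) refl (x / y)
           , solve 1 (λ q → q := :0 :+ q :* (:1 :- :0)) refl (x / y)))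

  -- Division already suffices, as x y = x / (1 / y) for y ≠ 0.
  K-* : ∀ {x y} → K x → K y → K (x * y)
  K-* {x} {y} Kx Ky with ≈0-or-≉0 y
  ... | inj₁ y≈0 = K-resp (sym (trans (*-congˡ y≈0) (zeroʳ x))) origin
  ... | inj₂ y≉0 = K-resp
          (*-cancelˡ 1/y≉0 (trans (/-cancel 1/y≉0) (sym (combine₁ x (/-cancel {1#} y≉0)
            (solve 3 (λ x y i → i :* (x :* y) :- x := x :* (y :* i :- :1)) refl x y (1# / y))))))
          (K-/ Kx (K-/ unit Ky y≉0) 1/y≉0)
    where
    1/y≉0 : 1# / y ≉ 0#
    1/y≉0 e = >⇒≉ 0<1 (trans (sym (/-cancel {1#} y≉0)) (trans (*-congˡ e) (zeroʳ y)))

  K-½ : K ½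
  K-½ = K-resp (*-identityˡ ½) (K-/ unit (K-+ unit unit) 2≉0)

  -- The circle with diameter from (−1, 0) to (x, 0) meets the vertical axis at
  -- height √x.
  K-sqrt : ∀ {x y} → K x → 0# < x → IsSqrt x y → K y
  K-sqrt {x} {y} Kx 0<x (_ , yy≈x) = horizontal
    (line∩circle origin (vertical unit) (λ (_ , 0≈1) → >⇒≉ 0<1 (sym 0≈1))
      (K-* (K-sub Kx unit) K-½) Kx
      (λ (c≈x , _) → >⇒≉ (+-pos 0<x 0<1) (combine₂ (- 2#) c≈x (x - 1#) 2*½
        (solve 2 (λ x h → x :+ :1 :- :0 := :- :2 :* ((x :- :1) :* h :- x)
            :+ (x :- :1) :* (:2 :* h :- :1)) refl x ½)))
      (y , solve 1 (λ y → :0 := :0 :+ y :* (:0 :- :0)) refl y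
         , solve 1 (λ y → y := :0 :+ y :* (:1 :- :0)) refl y)
      (combine₂ 1# yy≈x (x * (x - 1#)) 2*½
        (solve 3 (λ x y h →
            let c = (x :- :1) :* h
            in (:0 :- c) :* (:0 :- c) :+ (y :- :0) :* (y :- :0)
                 :- ((x :- c) :* (x :- c) :+ (:0 :- :0) :* (:0 :- :0)) :=
               :1 :* (y :* y :- x) :+ x :* (x :- :1) :* (:2 :* h :- :1))
          refl x y ½)))

  obtainable⇒constructed : ∀ {_↦_ : ℝ → ℝ → Set} → (∀ {x y} → K x → x ↦ y → K y) →
                           ∀ {x} → Obtainable _↦_ x → K x
  obtainable⇒constructed {_↦_} K-extra = go
    where
    go : ∀ {x} → Obtainable _↦_ x → K x
    go one               = unit
    go (add x y)         = K-+ (go x) (go y)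
    go (sub x y)         = K-sub (go x) (go y)
    go (mul x y)         = K-* (go x) (go y)
    go (div x y y≉0)     = K-/ (go x) (go y) y≉0
    go (sqrt x 0<x root) = K-sqrt (go x) 0<x root
    go (extra x x↦y)     = K-extra (go x) x↦y
    go (resp x≈y x)      = K-resp x≈y (go x)

  constructed⇒constructible : ∀ {r} → K r → Constructible τ r
  constructed⇒constructible {r} Kr = (0# , 0#) , (r , 0#) , origin , Kr , ∣∣-nonneg r ,
    trans (∣∣-square r)
      (solve 1 (λ r → r :* r := (r :- :0) :* (r :- :0) :+ (:0 :- :0) :* (:0 :- :0)) refl r)

-- The two angle tools on the unit circle

module AngleTools (em : ExcludedMiddle 0ℓ) (R : CompleteOrderedField) (T : Trigonometry R) where
  open CompleteOrderedField R
  open Trigonometry T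
  open IntegerSolver commutativeRing
  open OrderedField R
  open Analysis em R using (_·½; archimedean)
  open SinCos em R T
  open Constructions R T

  axis-length : ∀ {x} → 0# ≤ x → HasLength (0# , 0#) (x , 0#) x
  axis-length {x} 0≤x = 0≤x ,
    solve 1 (λ x → x :* x := (x :- :0) :* (x :- :0) :+ (:0 :- :0) :* (:0 :- :0)) refl x

  unit-direction : ℝ → Point
  unit-direction θ = (cos θ , sin θ)

  direction-length : ∀ θ → HasLength (0# , 0#) (unit-direction θ) 1#
  direction-length θ = <⇒≤ 0<1 , sym (combine₁ 1# (sin²+cos²≈1 θ)
    (solve 2 (λ s c → (c :- :0) :* (c :- :0) :+ (s :- :0) :* (s :- :0) :- :1 :* :1 :=
        :1 :* (s :* s :+ c :* c :- :1)) refl (sin θ) (cos θ)))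

  direction≉0 : ∀ θ → unit-direction θ ≉ₚ (0# , 0#)
  direction≉0 θ (c≈0 , s≈0) = >⇒≉ 0<1 (trans (sym (sin²+cos²≈1 θ))
    (trans (+-cong (*-cong s≈0 s≈0) (*-cong c≈0 c≈0)) (solve 0 (:0 :* :0 :+ :0 :* :0 := :0) refl)))

  unit≉0 : (1# , 0#) ≉ₚ (0# , 0#)
  unit≉0 (1≈0 , _) = >⇒≉ 0<1 1≈0

  -- The anglesector writes its angle as p / q times π / 2, which is merely equal to the argument of
  -- the direction; hence two names for one angle.
  direction-angle : ∀ {θ θ′} → θ ≈ θ′ → 0# ≤ θ → θ ≤ π →
                    HasAngle (1# , 0#) (0# , 0#) (unit-direction θ) θ′
  direction-angle {θ} {θ′} θ≈θ′ 0≤θ θ≤π =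
    unit≉0 , direction≉0 θ , ≤-respʳ θ≈θ′ 0≤θ , ≤-respˡ θ≈θ′ θ≤π ,
    1# , 1# , axis-length (<⇒≤ 0<1) , direction-length θ ,
    combine₁ 1# (cos-cong θ≈θ′)
      (solve 3 (λ s c c′ → (:1 :- :0) :* (c :- :0) :+ (:0 :- :0) :* (s :- :0) :- :1 :* :1 :* c′ :=
          :1 :* (c :- c′)) refl (sin θ) (cos θ) (cos θ′))

  axes-right-angle : IsRightAngle (1# , 0#) (0# , 0#) (0# , 1#)
  axes-right-angle =
    unit≉0 , (λ (_ , 1≈0) → >⇒≉ 0<1 1≈0) , <⇒≤ 0<π/2 , <⇒≤ π/2<π ,
    1# , 1# , axis-length (<⇒≤ 0<1) ,
    (<⇒≤ 0<1 , solve 0 (:1 :* :1 := (:0 :- :0) :* (:0 :- :0) :+ (:1 :- :0) :* (:1 :- :0)) refl) ,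
    combine₁ (- 1#) cos-π/2
      (solve 1 (λ c → (:1 :- :0) :* (:0 :- :0) :+ (:0 :- :0) :* (:1 :- :0) :- :1 :* :1 :* c :=
          :- :1 :* (c :- :0)) refl (cos (π / 2#)))

  first-quadrant : ∀ {θ} → 0# ≤ θ → θ ≤ π / 2# →
                   InsideAngle (1# , 0#) (0# , 0#) (0# , 1#) (unit-direction θ)
  first-quadrant {θ} 0≤θ θ≤π/2 =
    cos θ , sin θ , cos-nonneg 0≤θ θ≤π/2 , sin-nonneg 0≤θ (≤-trans θ≤π/2 (<⇒≤ π/2<π)) ,
    solve 2 (λ c s → c := :0 :+ c :* (:1 :- :0) :+ s :* (:0 :- :0)) refl (cos θ) (sin θ) ,
    solve 2 (λ c s → s := :0 :+ c :* (:0 :- :0) :+ s :* (:1 :- :0)) refl (cos θ) (sin θ)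

  module WithRA where
    open RulerAndCompass R T RA
    open ConstructedNumbers em R T RA

    -- Both values are carried along because a quarter turn exchanges them up to sign.
    SinCosConstructed : ℝ → Set
    SinCosConstructed x = K (sin (π * x)) × K (cos (π * x))

    sin-cos-constructed : ∀ {x} → K x → 0# ≤ x → x ≤ ½ → SinCosConstructed x
    sin-cos-constructed {x} Kx 0≤x x≤½ = ordinate CW , abscissa CW
      where
      W = unit-direction (π * x)
      angle≈ : π * x ≈ 2# * x / 1# * (π / 2#)
      angle≈ = sym (combine₂ (2# * π * ½ * x) (*-inverseʳ 1# (>⇒≉ 0<1)) (π * x) 2*½
        (solve 4 (λ π x h i → :2 :* x :* i :* (π :* h) :- π :* x :=
            :2 :* π :* h :* x :* (:1 :* i :- :1) :+ π :* x :* (:2 :* h :- :1)) refl π x ½ (1# ⁻¹)))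
      0≤πx = *-nonneg (<⇒≤ 0<π) 0≤x
      πx≤π/2 : π * x ≤ π / 2#
      πx≤π/2 = *-monoˡ-≤ (<⇒≤ 0<π) x≤½
      2x≤1 : 2# * x ≤ 1#
      2x≤1 = ≤-respʳ 2*½ (*-monoˡ-≤ (<⇒≤ 0<2) x≤½)
      CW : C W
      CW = intersect
        -- Segments of lengths 2x and 1 give the angle 2x · π/2 = πx; the condition p ≤ q is x ≤ ½.
        (anglesect unit origin (vertical unit) axes-right-angle
          origin (K-* (K-+ unit unit) Kx) (axis-length (*-nonneg (<⇒≤ 0<2) 0≤x))
          origin unit (axis-length (<⇒≤ 0<1)) 0<1 2x≤1
          (first-quadrant 0≤πx πx≤π/2)
          (direction-angle angle≈ 0≤πx (≤-trans πx≤π/2 (<⇒≤ π/2<π))))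
        (compass origin unit (λ (0≈1 , _) → >⇒≉ 0<1 (sym 0≈1)))
        (line-circle-distinct (λ (e₁ , e₂) → direction≉0 (π * x) (sym e₁ , sym e₂)))
        (1# , <⇒≤ 0<1 , along (cos (π * x)) , along (sin (π * x)))
        (trans (sym (proj₂ (direction-length (π * x)))) (proj₂ (axis-length (<⇒≤ 0<1))))
        where
        along : ∀ a → a ≈ 0# + 1# * (a - 0#)
        along = solve 1 (λ a → a := :0 :+ :1 :* (a :- :0)) refl

    add-½ : ∀ {x} → SinCosConstructed (x - ½) → SinCosConstructed x
    add-½ {x} (Ksin , Kcos) =
      K-resp (trans (sym (sin-+π/2 _)) (sin-cong shift)) Kcos ,
      K-resp (sym (trans (cos-cong (sym shift)) (trans (cos-+ _ _)
        (combine₂ (cos y) cos-π/2 (- sin y) sin-π/2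
          (solve 4 (λ s c s′ c′ → c :* c′ :- s :* s′ :- :- s := c :* (c′ :- :0) :+ :- s :* (s′ :- :1))
            refl (sin y) (cos y) (sin (π / 2#)) (cos (π / 2#))))))) (K-neg Ksin)
      where
      y = π * (x - ½)
      shift : y + π / 2# ≈ π * x
      shift = solve 3 (λ π x h → π :* (x :- h) :+ π :* h := π :* x) refl π x ½

    nonneg-sin-cos-constructed : ∀ n {x} → K x → 0# ≤ x → x ≤ n ·½ → SinCosConstructed x
    nonneg-sin-cos-constructed zero Kx 0≤x x≤0 =
      sin-cos-constructed Kx 0≤x (≤-trans x≤0 (<⇒≤ 0<½))
    nonneg-sin-cos-constructed (suc n) {x} Kx 0≤x x≤ with <-or-≥ x ½
    ... | inj₁ x<½ = sin-cos-constructed Kx 0≤x (<⇒≤ x<½)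
    ... | inj₂ ½≤x = add-½ (nonneg-sin-cos-constructed n (K-sub Kx K-½) (0≤difference ½≤x)
            (≤-from-difference (0≤difference x≤)
              (solve 3 (λ a x h → a :- (x :- h) := a :+ h :- x) refl (n ·½) x ½)))

    K-sinπ : ∀ {x y} → K x → SinπGraph x y → K y
    K-sinπ {x} Kx y≈ with <-or-≥ x 0#
    ... | inj₂ 0≤x = K-resp (sym y≈)
            (proj₁ (nonneg-sin-cos-constructed (proj₁ (archimedean 0≤x)) Kx 0≤x (proj₂ (archimedean 0≤x))))
    ... | inj₁ x<0 = K-resp
            (trans (sym (sin-neg _)) (trans (sin-cong (solve 2 (λ π x → :- (π :* :- x) := π :* x) refl π x))
              (sym y≈)))
            (K-neg (proj₁ (nonneg-sin-cos-constructed (proj₁ (archimedean 0≤-x)) (K-neg Kx) 0≤-x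
              (proj₂ (archimedean 0≤-x)))))
      where 0≤-x = <⇒≤ (neg-pos x<0)

  module WithRRA where
    open RulerAndCompass R T RRA
    open ConstructedNumbers em R T RRA

    -- `divide` demands 0 < θ < π/2, so the ends are supplied directly as 0 and ½. In between it
    -- marks 2θ/π on the unit segment, which is then halved.
    K-angle/π : ∀ {x θ} → K x → 0# ≤ θ → θ ≤ π / 2# → sin θ ≈ x → K ((1# / π) * θ)
    K-angle/π Kx (inj₂ 0≈θ) _ _ = K-resp (trans (sym (zeroʳ _)) (*-congˡ 0≈θ)) origin
    K-angle/π Kx (inj₁ _) (inj₂ θ≈π/2) _ = K-resp
      (sym (trans (*-congˡ θ≈π/2) (combine₁ ½ (*-inverseʳ π (>⇒≉ 0<π))
        (solve 3 (λ π i h → :1 :* i :* (π :* h) :- h := h :* (π :* i :- :1)) refl π (π ⁻¹) ½))))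
      K-½
    K-angle/π {x} {θ} Kx (inj₁ 0<θ) (inj₁ θ<π/2) sin≈x = K-resp
      (combine₁ (θ / π) 2*½
        (solve 3 (λ θ i h → h :* (:0 :+ :2 :* θ :* i :* (:1 :- :0)) :- :1 :* i :* θ :=
            θ :* i :* (:2 :* h :- :1)) refl θ (π ⁻¹) ½))
      (K-* K-½ (abscissa (divide unit origin (vertical unit) axes-right-angle
        (point (Kcos (cos-nonneg 0≤θ (<⇒≤ θ<π/2))) (K-resp (sym sin≈x) Kx))
        (first-quadrant 0≤θ (<⇒≤ θ<π/2))
        (direction-angle refl 0≤θ (<⇒≤ (<-trans θ<π/2 π/2<π))) 0<θ θ<π/2 origin unit)))
      where
      0≤θ = <⇒≤ 0<θ
      Kcos² : K (cos θ * cos θ)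
      Kcos² = K-resp
        (combine₂ (- 1#) (sin²+cos²≈1 θ) (sin θ + x) sin≈x
          (solve 3 (λ s c x → (:1 :- x :* x) :- c :* c :=
              :- :1 :* (s :* s :+ c :* c :- :1) :+ (s :+ x) :* (s :- x)) refl (sin θ) (cos θ) x))
        (K-sub unit (K-* Kx Kx))
      Kcos : 0# ≤ cos θ → K (cos θ)
      Kcos (inj₁ 0<cos) = K-sqrt Kcos² (*-pos 0<cos 0<cos) (<⇒≤ 0<cos , refl)
      Kcos (inj₂ 0≈cos) = K-resp 0≈cos origin

    K-arcsin/π : ∀ {x y} → K x → Arcsin/πGraph x y → K y
    K-arcsin/π {x} Kx (_ , θ , (-π/2≤θ , θ≤π/2 , sin≈x) , y≈) with <-or-≥ θ 0#
    ... | inj₂ 0≤θ = K-resp (sym y≈) (K-angle/π Kx 0≤θ θ≤π/2 sin≈x)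
    ... | inj₁ θ<0 = K-resp
            (sym (trans y≈ (solve 2 (λ i θ → i :* θ := :- (i :* :- θ)) refl (1# / π) θ)))
            (K-neg (K-angle/π (K-neg Kx) (<⇒≤ (neg-pos θ<0))
              (≤-respʳ (solve 1 (λ p → :- :- p := p) refl (π / 2#)) (neg-≤ -π/2≤θ))
              (trans (sin-neg θ) (-‿cong sin≈x))))

theorem7p2 : ExcludedMiddle 0ℓ → (R : CompleteOrderedField) (T : Trigonometry R) →
    let open CompleteOrderedField R using (ℝ)
        open Constructions R T
    in ((r : ℝ) → Constructible RA r ⇔ Obtainable SinπGraph r)
     × ((r : ℝ) → Constructible RRA r ⇔ Obtainable Arcsin/πGraph r)
theorem7p2 em R T =
  (λ _ → mk⇔ constructible⇒obtainable
    (λ r → ConstructedNumbers.constructed⇒constructible em R T RA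
      (ConstructedNumbers.obtainable⇒constructed em R T RA WithRA.K-sinπ r))) ,
  (λ _ → mk⇔ constructible⇒obtainable
    (λ r → ConstructedNumbers.constructed⇒constructible em R T RRA
      (ConstructedNumbers.obtainable⇒constructed em R T RRA WithRRA.K-arcsin/π r)))
  where
  open Soundness em R T
  open AngleTools em R T
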